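{- For any positive integer $n$, $$\sum_{\pi\in\mathcal S_n}s^{\mathrm{rmin}(\pi)}x^{p_{\rm silly}(\pi)}w^{\mathrm{des}(\pi)}=\sum_{M\in\mathcal N_n}s^{\min(M)}x^{\mathrm{rne}(M)}w^{\mathrm{int}(M)-1}.$$
   Context: **Permutations.** $\mathcal S_n$ is the set of permutations $\pi=\pi(1)\cdots\pi(n)$ of $[n]=\{1,\dots,n\}$. $\mathrm{rmin}(\pi)$ is the number of values $\pi(j)$ with $\pi(j)<\pi(k)$ for all $k>j$. $p_{\rm silly}(\pi)$ is the number of indices $j$ such that $j=1$ or $\pi(j-1)<\pi(j)$, $\pi(j)<n$, and the value $\pi(j)+1$ occurs to the left of $\pi(j)$ in $\pi(1)\cdots\pi(n)$. $\mathrm{des}(\pi)$ is the number of $j\in\{2,\dots,n\}$ with $\pi(j-1)>\pi(j)$. **Matchings.** A matching $M$ of size $n$ is a partition of $[2n]$ into 2-element arcs; an arc $A$ has opener $\mathrm{op}(A)=\min A$ and closer $\mathrm{cl}(A)=\max A$. Arcs are numbered $M_1,\dots,M_n$ by increasing closer. A left nesting is a pair of arcs $A,B$ with $\mathrm{op}(B)<\mathrm{op}(A)<\mathrm{cl}(A)<\mathrm{cl}(B)$ and $\mathrm{op}(A)=\mathrm{op}(B)+1$. $\mathcal N_n$ is the set of matchings of size $n$ with no left nesting. $\mathrm{rne}(M)$ is the number of $i$ with $\mathrm{op}(M_i)<\mathrm{op}(M_{i-1})<\mathrm{cl}(M_{i-1})=\mathrm{cl}(M_i)-1$. $\min(M)=\#\{i:\mathrm{op}(M_i)<\mathrm{cl}(M_1)\}$.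 $\mathrm{int}(M)=n-\#\{i\in\{2,\dots,n\}:\mathrm{cl}(M_{i-1})=\mathrm{cl}(M_i)-1\}$, i.e. the number of maximal runs of consecutive closers in $1,2,\dots,2n$. -}

module Defs where

open import Algebra.Bundles using (CommutativeSemiring)
import Algebra.Properties.Semiring.Exp as Exp
open import Data.Fin.Base using (Fin; toℕ; _<_)
open import Data.Fin.Properties using (_≟_; _<?_; all?; any?)
open import Data.List.Base
  using (List; []; _∷_; allFin; cartesianProduct; cartesianProductWith; filter; foldr; length; map)
open import Data.Nat.Base as ℕ using (ℕ; zero; suc; _∸_)
import Data.Nat.Properties as ℕ
open import Data.Product using (∃; ∃!; _×_; _,_; proj₁; proj₂)
open import Data.Sum.Base using (_⊎_)
open import Data.Vec.Base using (Vec; []; _∷_; lookup)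
open import Function.Definitions using (Bijective)
open import Level using (Level)
open import Relation.Binary.PropositionalEquality using (_≡_; refl)
open import Relation.Nullary.Decidable using (Dec; map′; ¬?; _×-dec_; _⊎-dec_; _→-dec_)
open import Relation.Nullary.Negation using (¬_)
open import Relation.Unary using (Pred; Decidable)

private
  variable
    a p : Level
    A : Set a
    m n : ℕ

-- The sets [n] and [2n] are modelled by Fin n and Fin (2 * n), so every
-- index, value and endpoint is shifted down by one.

#[_] : {P : Pred (Fin n) p} → Decidable P → ℕ
#[ P? ] = length (filter P? (allFin _))

-- If xs lists a finite set without repetition, so does words xs n for the
-- words of length n over it; filtering it then enumerates 𝒮 n and 𝒩 n with
-- every element listed once.
words : List A → (n : ℕ) → List (Vec A n)
words xs zero    = [] ∷ []
words xs (suc n) = cartesianProductWith _∷_ xs (words xs n)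

-- i ⋖ j means j = i + 1.
infix 4 _⋖_ _⋖?_

_⋖_ : Fin n → Fin n → Set
i ⋖ j = toℕ j ≡ suc (toℕ i)

_⋖?_ : (i j : Fin n) → Dec (i ⋖ j)
i ⋖? j = toℕ j ℕ.≟ suc (toℕ i)

bijective? : (f : Fin n → Fin n) → Dec (Bijective _≡_ _≡_ f)
bijective? f =
  map′ (λ inj {x} {y} → inj x y) (λ inj x y → inj {x} {y})
       (all? λ x → all? λ y → (f x ≟ f y) →-dec (x ≟ y))
  ×-dec
  map′ (λ sur y → proj₁ (sur y) , λ { refl → proj₂ (sur y) })
       (λ sur y → proj₁ (sur y) , proj₂ (sur y) refl)
       (all? λ y → any? λ x → f x ≟ y)

unique? : {P : Pred (Fin n) p} → Decidable P → Dec (∃! _≡_ P)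
unique? P? =
  map′ (λ (x , px , uniq) → x , px , λ {y} → uniq y)
       (λ (x , px , uniq) → x , px , λ y → uniq {y})
       (any? λ x → P? x ×-dec all? λ y → P? y →-dec (x ≟ y))

-- Permutations are given by their one-line notation π(1)⋯π(n).

IsPermutation : Vec (Fin n) n → Set
IsPermutation π = Bijective _≡_ _≡_ (lookup π)

isPermutation? : Decidable (IsPermutation {n})
isPermutation? π = bijective? (lookup π)

𝒮 : (n : ℕ) → List (Vec (Fin n) n)
𝒮 n = filter isPermutation? (words (allFin n) n)

module _ {n : ℕ} (π : Vec (Fin n) n) where

  private
    π⟨_⟩ : Fin n → Fin n
    π⟨ j ⟩ = lookup π j

  IsRightToLeftMinimum : Fin n → Set
  IsRightToLeftMinimum j = ∀ k → j < k → π⟨ j ⟩ < π⟨ k ⟩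

  isRightToLeftMinimum? : Decidable IsRightToLeftMinimum
  isRightToLeftMinimum? j = all? λ k → (j <? k) →-dec (π⟨ j ⟩ <? π⟨ k ⟩)

  IsSilly : Fin n → Set
  IsSilly j =
    (toℕ j ≡ 0 ⊎ ∃ λ i → i ⋖ j × π⟨ i ⟩ < π⟨ j ⟩)
    × suc (toℕ π⟨ j ⟩) ℕ.< n
    × ∃ λ k → k < j × π⟨ j ⟩ ⋖ π⟨ k ⟩

  isSilly? : Decidable IsSilly
  isSilly? j =
    ((toℕ j ℕ.≟ 0) ⊎-dec any? λ i → (i ⋖? j) ×-dec (π⟨ i ⟩ <? π⟨ j ⟩))
    ×-dec (suc (toℕ π⟨ j ⟩) ℕ.<? n)
    ×-dec any? λ k → (k <? j) ×-dec (π⟨ j ⟩ ⋖? π⟨ k ⟩)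

  IsDescent : Fin n → Set
  IsDescent j = ∃ λ i → i ⋖ j × π⟨ j ⟩ < π⟨ i ⟩

  isDescent? : Decidable IsDescent
  isDescent? j = any? λ i → (i ⋖? j) ×-dec (π⟨ j ⟩ <? π⟨ i ⟩)

  rmin : ℕ
  rmin = #[ isRightToLeftMinimum? ]

  p-silly : ℕ
  p-silly = #[ isSilly? ]

  des : ℕ
  des = #[ isDescent? ]

Arc : ℕ → Set
Arc m = Fin m × Fin m

op : Arc m → Fin m
op = proj₁

cl : Arc m → Fin m
cl = proj₂

-- A matching is given by the list M₁, …, Mₙ of its arcs in order of
-- increasing closer. Closers of distinct arcs differ, so each matching is
-- represented by exactly one such list.

IsMatching : Vec (Arc (2 ℕ.* n)) n → Set
IsMatching M =
  (∀ i → op (lookup M i) < cl (lookup M i))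
  × (∀ i j → i < j → cl (lookup M i) < cl (lookup M j))
  × (∀ q → ∃! _≡_ λ i → q ≡ op (lookup M i) ⊎ q ≡ cl (lookup M i))

isMatching? : Decidable (IsMatching {n})
isMatching? M =
  (all? λ i → op (lookup M i) <? cl (lookup M i))
  ×-dec (all? λ i → all? λ j → (i <? j) →-dec (cl (lookup M i) <? cl (lookup M j)))
  ×-dec (all? λ q → unique? λ i → (q ≟ op (lookup M i)) ⊎-dec (q ≟ cl (lookup M i)))

LeftNesting : Arc m → Arc m → Set
LeftNesting A B = op B < op A × op A < cl A × cl A < cl B × op B ⋖ op A

leftNesting? : (A B : Arc m) → Dec (LeftNesting A B)
leftNesting? A B =
  (op B <? op A) ×-dec (op A <? cl A) ×-dec (cl A <? cl B) ×-dec (op B ⋖? op A)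

NoLeftNesting : Vec (Arc (2 ℕ.* n)) n → Set
NoLeftNesting M = ∀ i j → ¬ LeftNesting (lookup M i) (lookup M j)

noLeftNesting? : Decidable (NoLeftNesting {n})
noLeftNesting? M = all? λ i → all? λ j → ¬? (leftNesting? (lookup M i) (lookup M j))

𝒩 : (n : ℕ) → List (Vec (Arc (2 ℕ.* n)) n)
𝒩 n = filter (λ M → isMatching? M ×-dec noLeftNesting? M)
             (words (cartesianProduct (allFin (2 ℕ.* n)) (allFin (2 ℕ.* n))) n)

module _ {n : ℕ} (M : Vec (Arc (2 ℕ.* n)) n) where

  private
    M⟨_⟩ : Fin n → Arc (2 ℕ.* n)
    M⟨ i ⟩ = lookup M i

  IsRightNesting : Fin n → Set
  IsRightNesting i = ∃ λ h → h ⋖ i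
    × op M⟨ i ⟩ < op M⟨ h ⟩ × op M⟨ h ⟩ < cl M⟨ h ⟩ × cl M⟨ h ⟩ ⋖ cl M⟨ i ⟩

  isRightNesting? : Decidable IsRightNesting
  isRightNesting? i = any? λ h → (h ⋖? i)
    ×-dec (op M⟨ i ⟩ <? op M⟨ h ⟩) ×-dec (op M⟨ h ⟩ <? cl M⟨ h ⟩) ×-dec (cl M⟨ h ⟩ ⋖? cl M⟨ i ⟩)

  -- Quantifying over the index with toℕ h ≡ 0 selects M₁ without having to
  -- assume n > 0.
  OpensBeforeFirstCloser : Fin n → Set
  OpensBeforeFirstCloser i = ∃ λ h → toℕ h ≡ 0 × op M⟨ i ⟩ < cl M⟨ h ⟩

  opensBeforeFirstCloser? : Decidable OpensBeforeFirstCloser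
  opensBeforeFirstCloser? i = any? λ h → (toℕ h ℕ.≟ 0) ×-dec (op M⟨ i ⟩ <? cl M⟨ h ⟩)

  ContinuesRun : Fin n → Set
  ContinuesRun i = ∃ λ h → h ⋖ i × cl M⟨ h ⟩ ⋖ cl M⟨ i ⟩

  continuesRun? : Decidable ContinuesRun
  continuesRun? i = any? λ h → (h ⋖? i) ×-dec (cl M⟨ h ⟩ ⋖? cl M⟨ i ⟩)

  rne : ℕ
  rne = #[ isRightNesting? ]

  min : ℕ
  min = #[ opensBeforeFirstCloser? ]

  -- The subtraction never truncates, since at most n indices are counted.
  int : ℕ
  int = n ∸ #[ continuesRun? ]

-- An identity of polynomials in s, x, w with natural number coefficients is
-- an identity of their values at all s, x, w in all commutative semirings:
-- ℕ[s,x,w] is the free commutative semiring on s, x, w.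

module Polynomial {c ℓ} (R : CommutativeSemiring c ℓ) where

  open CommutativeSemiring R public using (Carrier; _≈_; _*_)
  open CommutativeSemiring R using (_+_; 0#; semiring)
  open Exp semiring public using (_^_)

  sumOver : List A → (A → Carrier) → Carrier
  sumOver xs f = foldr _+_ 0# (map f xs)

  infix 5 sumOver
  syntax sumOver xs (λ y → e) = ∑[ y ∈ xs ] e

{-# OPTIONS --safe #-}

-- A matching without left nestings is the same as a code a(0), …, a(n − 1)
-- with a(i) ≤ i: the i-th arc opens in the block of openers just before the
-- closer a(i), and inside a block the openers must be ordered like their
-- closers. Then min counts the zeros of a, int its distinct values, and rne
-- the i > 0 that are not values of a and satisfy a(i) < a(i − 1).
--
-- A permutation has a code b as well: b(v) names the next entry to the right
-- of v that is smaller than v (zero if there is none, u + 1 for the entry u).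
-- Its zeros are the right-to-left minima, its nonzero values the descent
-- bottoms, and v is silly iff v + 1 < n is not a value of b and the gap
-- b(v + 1) lies to the left of the gap b(v).
--
-- Cut the indices into runs, each starting at a value of the code; on a run
-- all letters come from the same alphabet. The two descriptions differ in the
-- order put on the letters and in the direction in which a run is read.
-- Reversing each run, and replacing its letters along the increasing bijection
-- between the two orders on the set of letters that occur in it, turns b into
-- a; the set of values, hence the runs, does not change. This map is
-- injective, and surjectivity follows by counting.

module Submission where

open import Algebra.Bundles using (CommutativeSemiring)
open import Data.Empty using (⊥-elim)
open import Data.Fin.Base as Fin using (Fin; zero; suc; toℕ; fromℕ; fromℕ<; punchIn; inject₁)
import Data.Fin.Properties as Fin
open import Data.Fin.Relation.Unary.Top using (view; ‵fromℕ; ‵inject₁)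
open import Data.List.Base as List using (List; []; _∷_; [_]; _++_; length; filter; allFin; map; cartesianProduct)
import Data.List.Properties as List
open import Data.List.Membership.Propositional using (_∈_)
open import Data.List.Membership.Propositional.Properties
  using (∈-∃++; ∈-++⁻; ∈-++⁺ˡ; ∈-++⁺ʳ; ∈-filter⁺; ∈-filter⁻; ∈-allFin; ∈-map⁺; ∈-map⁻;
         ∈-cartesianProductWith⁺; ∈-cartesianProduct⁺)
open import Data.List.Relation.Unary.All as All using ()
open import Data.List.Relation.Unary.AllPairs using ([]; _∷_)
open import Data.List.Relation.Unary.Any using (here; there)
open import Data.List.Relation.Unary.Unique.Propositional using (Unique)
import Data.List.Relation.Unary.Unique.Propositional.Properties as Unique
open import Data.Nat.Base as ℕ using (ℕ; zero; suc; _+_; _∸_; _≤_; _<_; z≤n; s≤s; s≤s⁻¹; NonZero; >-nonZero⁻¹)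
import Data.Nat.Properties as ℕ
open import Data.Product using (∃; ∃₂; ∃!; _×_; _,_; proj₁; proj₂)
open import Data.Sum.Base as Sum using (_⊎_; inj₁; inj₂; [_,_]′)
open import Data.Sum.Properties using (inj₁-injective; inj₂-injective)
open import Data.Unit.Base using (⊤; tt)
open import Data.Vec.Base as Vec using (Vec; []; _∷_; lookup)
import Data.Vec.Properties as Vec
open import Function.Base using (_∘_; id; _$_; case_of_)
open import Level using (0ℓ)
open import Relation.Binary.Definitions using (tri<; tri≈; tri>)
open import Relation.Binary.PropositionalEquality
  using (_≡_; _≢_; refl; sym; trans; cong; cong₂; subst; subst₂; module ≡-Reasoning)
open import Relation.Nullary using (¬_; Dec; yes; no; ¬?; _×-dec_; _⊎-dec_)
open import Relation.Unary using (Pred; Decidable)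
open import Defs

-- Injective relations between lists, and counting

private
  variable
    A B : Set

module _ (R : A → B → Set) where

  -- A relation in place of a function: what an element is sent to depends on a proof (that a word
  -- is a permutation, that a list of arcs is a matching), and only membership in the list supplies
  -- that proof.
  Total : List A → List B → Set
  Total xs ys = ∀ {x} → x ∈ xs → ∃ λ y → y ∈ ys × R x y

  InjectiveOn : List A → Set
  InjectiveOn xs = ∀ {x x′ y} → x ∈ xs → x′ ∈ xs → R x y → R x′ y → x ≡ x′

module _ {R : A → B → Set} where

  ++-drop-total : ∀ {xs y} ys₁ {ys₂} → Total R xs (ys₁ ++ [ y ] ++ ys₂) →
                  (∀ {x} → x ∈ xs → ¬ R x y) → Total R xs (ys₁ ++ ys₂)
  ++-drop-total ys₁ tot ¬R x∈ with tot x∈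
  ... | y′ , y′∈ , r with ∈-++⁻ ys₁ y′∈
  ... | inj₁ p         = y′ , ∈-++⁺ˡ p , r
  ... | inj₂ (here refl) = ⊥-elim (¬R x∈ r)
  ... | inj₂ (there p) = y′ , ∈-++⁺ʳ ys₁ p , r

  -- By injectivity no other element of the list is related to `y`, so the partners of the remaining
  -- elements survive when `x` and `y` are removed together. This is the inductive step of all the
  -- counting below.
  tail-total : ∀ {x xs y} ys₁ {ys₂} → Unique (x ∷ xs) → Total R (x ∷ xs) (ys₁ ++ [ y ] ++ ys₂) →
               InjectiveOn R (x ∷ xs) → R x y → Total R xs (ys₁ ++ ys₂)
  tail-total ys₁ (x∉ ∷ _) tot inj r =
    ++-drop-total ys₁ (tot ∘ there) λ x′∈ r′ → All.lookup x∉ x′∈ (inj (here refl) (there x′∈) r r′)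

  length-insert : ∀ (ys₁ : List B) {y ys₂} → length (ys₁ ++ [ y ] ++ ys₂) ≡ suc (length (ys₁ ++ ys₂))
  length-insert ys₁ {y} {ys₂} = begin
    length (ys₁ ++ [ y ] ++ ys₂)       ≡⟨ List.length-++ ys₁ ⟩
    length ys₁ + suc (length ys₂)      ≡⟨ ℕ.+-suc _ _ ⟩
    suc (length ys₁ + length ys₂)      ≡⟨ cong suc (List.length-++ ys₁) ⟨
    suc (length (ys₁ ++ ys₂))          ∎
    where open ≡-Reasoning

  length-≤ : ∀ {xs ys} → Unique xs → Total R xs ys → InjectiveOn R xs → length xs ≤ length ys
  length-≤ {[]} _ _ _ = z≤n
  length-≤ {x ∷ xs} u@(_ ∷ u′) tot inj with tot (here refl)
  ... | y , y∈ , r with ∈-∃++ y∈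
  ... | ys₁ , ys₂ , refl = ℕ.≤-trans
    (s≤s (length-≤ u′ (tail-total ys₁ u tot inj r) λ p q → inj (there p) (there q)))
    (ℕ.≤-reflexive (sym (length-insert ys₁)))

  length-< : ∀ {xs ys y} → Unique xs → Total R xs ys → InjectiveOn R xs →
             y ∈ ys → (∀ {x} → x ∈ xs → ¬ R x y) → length xs < length ys
  length-< u tot inj y∈ ¬R with ∈-∃++ y∈
  ... | ys₁ , ys₂ , refl = ℕ.≤-trans (s≤s (length-≤ u (++-drop-total ys₁ tot ¬R) inj))
                                     (ℕ.≤-reflexive (sym (length-insert ys₁)))

  -- Pigeonhole: each element of `xs` uses up one element of `ys`, and since `ys` is no longer than
  -- `xs`, nothing is left over without a preimage.
  surjective-by-length : ∀ {xs ys} → Unique xs → Total R xs ys → InjectiveOn R xs →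
                         length ys ≤ length xs → ∀ {y} → y ∈ ys → ∃ λ x → x ∈ xs × R x y
  surjective-by-length {[]} {_ ∷ _} _ _ _ () _
  surjective-by-length {x ∷ xs} u@(_ ∷ u′) tot inj l≤ y∈ with tot (here refl)
  ... | y₀ , y₀∈ , r with ∈-∃++ y₀∈
  ... | ys₁ , ys₂ , refl = split (∈-++⁻ ys₁ y∈)
    where
    recurse : _ ∈ ys₁ ++ ys₂ → ∃ λ x′ → x′ ∈ x ∷ xs × R x′ _
    recurse p with surjective-by-length u′ (tail-total ys₁ u tot inj r) (λ p q → inj (there p) (there q))
                     (s≤s⁻¹ (ℕ.≤-trans (ℕ.≤-reflexive (sym (length-insert ys₁))) l≤)) p
    ... | x′ , x′∈ , r′ = x′ , there x′∈ , r′
    split : _ ∈ ys₁ ⊎ _ ∈ [ y₀ ] ++ ys₂ → ∃ λ x′ → x′ ∈ x ∷ xs × R x′ _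
    split (inj₁ p)           = recurse (∈-++⁺ˡ p)
    split (inj₂ (here refl)) = x , here refl , r
    split (inj₂ (there p))   = recurse (∈-++⁺ʳ ys₁ p)

  module _ {c ℓ} (S : CommutativeSemiring c ℓ) where
    open Polynomial S
    open CommutativeSemiring S using (+-cong; +-congˡ; +-assoc; +-comm)
      renaming (_+_ to _⊕_; refl to ≈-refl; sym to ≈-sym; trans to ≈-trans; setoid to ≈-setoid)

    sumOver-insert : ∀ ys₁ {y ys₂} (g : B → Carrier) →
                     sumOver (ys₁ ++ [ y ] ++ ys₂) g ≈ g y ⊕ sumOver (ys₁ ++ ys₂) g
    sumOver-insert [] g = ≈-refl
    sumOver-insert (y′ ∷ ys₁) {y} {ys₂} g = begin
      g y′ ⊕ sumOver (ys₁ ++ [ y ] ++ ys₂) g      ≈⟨ +-congˡ (sumOver-insert ys₁ g) ⟩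
      g y′ ⊕ (g y ⊕ sumOver (ys₁ ++ ys₂) g)       ≈⟨ +-assoc _ _ _ ⟨
      (g y′ ⊕ g y) ⊕ sumOver (ys₁ ++ ys₂) g       ≈⟨ +-cong (+-comm _ _) ≈-refl ⟩
      (g y ⊕ g y′) ⊕ sumOver (ys₁ ++ ys₂) g       ≈⟨ +-assoc _ _ _ ⟩
      g y ⊕ (g y′ ⊕ sumOver (ys₁ ++ ys₂) g)       ∎
      where open import Relation.Binary.Reasoning.Setoid ≈-setoid

    -- The terms are paired off one by one, each partner being moved to the front of the second sum.
    -- When `xs` is exhausted, the bound on the lengths leaves `ys` empty as well.
    sumOver-transport : ∀ {xs ys} {f : A → Carrier} {g : B → Carrier} →
      Unique xs → Total R xs ys → InjectiveOn R xs → length ys ≤ length xs →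
      (∀ {x y} → R x y → f x ≈ g y) → sumOver xs f ≈ sumOver ys g
    sumOver-transport {[]} {[]} _ _ _ _ _ = ≈-refl
    sumOver-transport {x ∷ xs} {g = g} u@(_ ∷ u′) tot inj l≤ f≈g with tot (here refl)
    ... | y , y∈ , r with ∈-∃++ y∈
    ... | ys₁ , ys₂ , refl = ≈-trans
      (+-cong (f≈g r) (sumOver-transport u′ (tail-total ys₁ u tot inj r) (λ p q → inj (there p) (there q))
        (s≤s⁻¹ (ℕ.≤-trans (ℕ.≤-reflexive (sym (length-insert ys₁))) l≤)) f≈g))
      (≈-sym (sumOver-insert ys₁ g))

-- Counting the indices that satisfy a predicate

module _ {m n} {P : Pred (Fin m) 0ℓ} {Q : Pred (Fin n) 0ℓ} (P? : Decidable P) (Q? : Decidable Q)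
         (R : Fin m → Fin n → Set) where

  private
    total : (∀ {i} → P i → ∃ λ k → Q k × R i k) → Total R (filter P? (allFin m)) (filter Q? (allFin n))
    total tot i∈ with tot (proj₂ (∈-filter⁻ P? {xs = allFin m} i∈))
    ... | k , q , r = k , ∈-filter⁺ Q? (∈-allFin k) q , r

    injOn : (∀ {i i′ k} → P i → P i′ → R i k → R i′ k → i ≡ i′) → InjectiveOn R (filter P? (allFin m))
    injOn inj i∈ i′∈ = inj (proj₂ (∈-filter⁻ P? {xs = allFin m} i∈)) (proj₂ (∈-filter⁻ P? {xs = allFin m} i′∈))

    unique : Unique (filter P? (allFin m))
    unique = Unique.filter⁺ P? (Unique.allFin⁺ m)

  #-≤ : (∀ {i} → P i → ∃ λ k → Q k × R i k) → (∀ {i i′ k} → P i → P i′ → R i k → R i′ k → i ≡ i′) →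
        #[ P? ] ≤ #[ Q? ]
  #-≤ tot inj = length-≤ unique (total tot) (injOn inj)

  #-< : (∀ {i} → P i → ∃ λ k → Q k × R i k) → (∀ {i i′ k} → P i → P i′ → R i k → R i′ k → i ≡ i′) →
        ∀ {k} → Q k → (∀ {i} → P i → ¬ R i k) → #[ P? ] < #[ Q? ]
  #-< tot inj q ¬R = length-< unique (total tot) (injOn inj) (∈-filter⁺ Q? (∈-allFin _) q)
    (λ i∈ → ¬R (proj₂ (∈-filter⁻ P? {xs = allFin m} i∈)))

  #-surjective : (∀ {i} → P i → ∃ λ k → Q k × R i k) → (∀ {i i′ k} → P i → P i′ → R i k → R i′ k → i ≡ i′) →
                 #[ Q? ] ≤ #[ P? ] → ∀ {k} → Q k → ∃ λ i → P i × R i k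
  #-surjective tot inj l≤ q
    with surjective-by-length unique (total tot) (injOn inj) l≤ (∈-filter⁺ Q? (∈-allFin _) q)
  ... | i , i∈ , r = i , proj₂ (∈-filter⁻ P? {xs = allFin m} i∈) , r

module _ {m n} {P : Pred (Fin m) 0ℓ} {Q : Pred (Fin n) 0ℓ} (P? : Decidable P) (Q? : Decidable Q)
         (R : Fin m → Fin n → Set) where

  #-≡ : (∀ {i} → P i → ∃ λ k → Q k × R i k) → (∀ {i i′ k} → P i → P i′ → R i k → R i′ k → i ≡ i′) →
        (∀ {k} → Q k → ∃ λ i → P i × R i k) → (∀ {i k k′} → Q k → Q k′ → R i k → R i k′ → k ≡ k′) →
        #[ P? ] ≡ #[ Q? ]
  #-≡ tot inj tot′ inj′ = ℕ.≤-antisym (#-≤ P? Q? R tot inj) (#-≤ Q? P? (λ k i → R i k) tot′ inj′)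

module _ {n} {P : Pred (Fin n) 0ℓ} {Q : Pred (Fin n) 0ℓ} (P? : Decidable P) (Q? : Decidable Q) where

  #-mono : (∀ {i} → P i → Q i) → #[ P? ] ≤ #[ Q? ]
  #-mono f = #-≤ P? Q? _≡_ (λ p → _ , f p , refl) (λ { _ _ refl refl → refl })

  #-mono-< : (∀ {i} → P i → Q i) → ∀ {k} → Q k → ¬ P k → #[ P? ] < #[ Q? ]
  #-mono-< f q ¬p = #-< P? Q? _≡_ (λ p → _ , f p , refl) (λ { _ _ refl refl → refl }) q λ { p refl → ¬p p }

  #-ext : (∀ {i} → P i → Q i) → (∀ {i} → Q i → P i) → #[ P? ] ≡ #[ Q? ]
  #-ext f g = #-≡ P? Q? _≡_ (λ p → _ , f p , refl) (λ { _ _ refl refl → refl })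
                            (λ q → _ , g q , refl) (λ { _ _ refl refl → refl })

module _ {l m n} {P : Pred (Fin l) 0ℓ} {Q : Pred (Fin m) 0ℓ} {T : Pred (Fin n) 0ℓ}
         (P? : Decidable P) (Q? : Decidable Q) (T? : Decidable T)
         (R : Fin l ⊎ Fin m → Fin n → Set) where

  private
    [P,Q] : Fin l ⊎ Fin m → Set
    [P,Q] = [ P , Q ]′

    ps : List (Fin l ⊎ Fin m)
    ps = map inj₁ (filter P? (allFin l))

    qs : List (Fin l ⊎ Fin m)
    qs = map inj₂ (filter Q? (allFin m))

    xs : List (Fin l ⊎ Fin m)
    xs = ps ++ qs

    ∈-xs⁻ : ∀ {s} → s ∈ xs → [P,Q] s
    ∈-xs⁻ s∈ with ∈-++⁻ ps s∈
    ... | inj₁ p with ∈-map⁻ inj₁ p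
    ... | i , i∈ , refl = proj₂ (∈-filter⁻ P? {xs = allFin l} i∈)
    ∈-xs⁻ s∈ | inj₂ q with ∈-map⁻ inj₂ q
    ... | i , i∈ , refl = proj₂ (∈-filter⁻ Q? {xs = allFin m} i∈)

    ∈-xs⁺ : ∀ s → [P,Q] s → s ∈ xs
    ∈-xs⁺ (inj₁ i) p = ∈-++⁺ˡ (∈-map⁺ inj₁ (∈-filter⁺ P? (∈-allFin i) p))
    ∈-xs⁺ (inj₂ i) q = ∈-++⁺ʳ ps (∈-map⁺ inj₂ (∈-filter⁺ Q? (∈-allFin i) q))

    unique : Unique xs
    unique = Unique.++⁺ (Unique.map⁺ inj₁-injective (Unique.filter⁺ P? (Unique.allFin⁺ l)))
                        (Unique.map⁺ inj₂-injective (Unique.filter⁺ Q? (Unique.allFin⁺ m)))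
                        disjoint
      where
      disjoint : ∀ {s} → ¬ (s ∈ ps × s ∈ qs)
      disjoint (p , q) with ∈-map⁻ inj₁ p | ∈-map⁻ inj₂ q
      ... | _ , _ , refl | _ , _ , ()

    length-xs : length xs ≡ #[ P? ] + #[ Q? ]
    length-xs = trans (List.length-++ ps) (cong₂ _+_ (List.length-map inj₁ (filter P? (allFin l)))
                                                     (List.length-map inj₂ (filter Q? (allFin m))))

  #-+ : (∀ s → [P,Q] s → ∃ λ k → T k × R s k) →
        (∀ {s s′ k} → [P,Q] s → [P,Q] s′ → R s k → R s′ k → s ≡ s′) →
        (∀ {k} → T k → ∃ λ s → [P,Q] s × R s k) →
        (∀ {s k k′} → T k → T k′ → R s k → R s k′ → k ≡ k′) →
        #[ P? ] + #[ Q? ] ≡ #[ T? ]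
  #-+ tot inj tot′ inj′ = trans (sym length-xs) (ℕ.≤-antisym
    (length-≤ {R = R} unique
      (λ {s} s∈ → case tot s (∈-xs⁻ s∈) of λ (k , t , r) → k , ∈-filter⁺ T? (∈-allFin k) t , r)
      (λ p q → inj (∈-xs⁻ p) (∈-xs⁻ q)))
    (length-≤ {R = λ k s → R s k} (Unique.filter⁺ T? (Unique.allFin⁺ n))
      (λ {k} k∈ → case tot′ (proj₂ (∈-filter⁻ T? {xs = allFin n} k∈)) of λ (s , pq , r) → s , ∈-xs⁺ s pq , r)
      (λ p q → inj′ (proj₂ (∈-filter⁻ T? {xs = allFin n} p)) (proj₂ (∈-filter⁻ T? {xs = allFin n} q)))))

  #-+-surjective : (∀ s → [P,Q] s → ∃ λ k → T k × R s k) →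
                   (∀ {s s′ k} → [P,Q] s → [P,Q] s′ → R s k → R s′ k → s ≡ s′) →
                   #[ T? ] ≤ #[ P? ] + #[ Q? ] → ∀ {k} → T k → ∃ λ s → [P,Q] s × R s k
  #-+-surjective tot inj l≤ t
    with surjective-by-length {R = R} unique
           (λ {s} s∈ → case tot s (∈-xs⁻ s∈) of λ (k , t , r) → k , ∈-filter⁺ T? (∈-allFin k) t , r)
           (λ p q → inj (∈-xs⁻ p) (∈-xs⁻ q))
           (ℕ.≤-trans l≤ (ℕ.≤-reflexive (sym length-xs)))
           (∈-filter⁺ T? (∈-allFin _) t)
  ... | s , s∈ , r = s , ∈-xs⁻ s∈ , r

#-full : ∀ n → #[ (λ (_ : Fin n) → yes tt) ] ≡ n
#-full n = trans (cong length (List.filter-all _ (All.universal (λ _ → tt) (allFin n)))) (List.length-tabulate id)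

#-below : ∀ {n} (k : ℕ) → k ≤ n → #[ (λ (j : Fin n) → toℕ j ℕ.<? k) ] ≡ k
#-below {n} k k≤n = trans
  (#-≡ (λ (j : Fin n) → toℕ j ℕ.<? k) (λ (_ : Fin k) → yes tt) (λ j i → toℕ j ≡ toℕ i)
    (λ j<k → fromℕ< j<k , _ , sym (Fin.toℕ-fromℕ< j<k))
    (λ _ _ p q → Fin.toℕ-injective (trans p (sym q)))
    (λ {i} _ → let i<n = ℕ.<-≤-trans (Fin.toℕ<n i) k≤n in
      fromℕ< i<n , ℕ.≤-trans (s≤s (ℕ.≤-reflexive (Fin.toℕ-fromℕ< i<n))) (Fin.toℕ<n i) , Fin.toℕ-fromℕ< i<n)
    (λ _ _ p q → Fin.toℕ-injective (trans (sym p) q)))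
  (#-full k)

injective⇒surjective : ∀ {n} {f : Fin n → Fin n} → (∀ {i j} → f i ≡ f j → i ≡ j) → ∀ y → ∃ λ x → f x ≡ y
injective⇒surjective {n} {f} inj y
  with #-surjective (λ (_ : Fin n) → yes tt) (λ (_ : Fin n) → yes tt) (λ i k → f i ≡ k)
         (λ _ → _ , tt , refl) (λ { _ _ p q → inj (trans p (sym q)) }) ℕ.≤-refl {y} tt
... | x , _ , fx≡y = x , fx≡y

-- Permutations and matchings as enumerated lists

lookup-ext : ∀ {A : Set} {n} {u v : Vec A n} → (∀ i → lookup u i ≡ lookup v i) → u ≡ v
lookup-ext {u = u} {v} eq =
  trans (sym (Vec.tabulate∘lookup u)) (trans (Vec.tabulate-cong eq) (Vec.tabulate∘lookup v))

words-unique : ∀ {A : Set} {xs : List A} → Unique xs → ∀ n → Unique (words xs n)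
words-unique u zero    = All.[] ∷ []
words-unique u (suc n) = Unique.cartesianProductWith⁺ _∷_ Vec.∷-injective u (words-unique u n)

∈-words : ∀ {A : Set} {xs : List A} → (∀ x → x ∈ xs) → ∀ {n} (v : Vec A n) → v ∈ words xs n
∈-words all []      = here refl
∈-words all (x ∷ v) = ∈-cartesianProductWith⁺ _∷_ (all x) (∈-words all v)

𝒮-unique : ∀ n → Unique (𝒮 n)
𝒮-unique n = Unique.filter⁺ isPermutation? (words-unique (Unique.allFin⁺ n) n)

∈-𝒮⁺ : ∀ {n} {π : Vec (Fin n) n} → IsPermutation π → π ∈ 𝒮 n
∈-𝒮⁺ {π = π} p = ∈-filter⁺ isPermutation? (∈-words ∈-allFin π) p

∈-𝒮⁻ : ∀ {n} {π : Vec (Fin n) n} → π ∈ 𝒮 n → IsPermutation π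
∈-𝒮⁻ {n} π∈ = proj₂ (∈-filter⁻ isPermutation? {xs = words (allFin n) n} π∈)

module _ {n : ℕ} where

  private
    arcs : List (Arc (2 ℕ.* n))
    arcs = cartesianProduct (allFin (2 ℕ.* n)) (allFin (2 ℕ.* n))

    ∈-arcs : ∀ A → A ∈ arcs
    ∈-arcs (p , q) = ∈-cartesianProduct⁺ (∈-allFin p) (∈-allFin q)

  𝒩-unique : Unique (𝒩 n)
  𝒩-unique = Unique.filter⁺ _
    (words-unique (Unique.cartesianProduct⁺ (Unique.allFin⁺ (2 ℕ.* n)) (Unique.allFin⁺ (2 ℕ.* n))) n)

  ∈-𝒩⁺ : ∀ {M : Vec (Arc (2 ℕ.* n)) n} → IsMatching M → NoLeftNesting M → M ∈ 𝒩 n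
  ∈-𝒩⁺ {M} m l = ∈-filter⁺ _ (∈-words ∈-arcs M) (m , l)

  ∈-𝒩⁻ : ∀ {M : Vec (Arc (2 ℕ.* n)) n} → M ∈ 𝒩 n → IsMatching M × NoLeftNesting M
  ∈-𝒩⁻ M∈ = proj₂ (∈-filter⁻ _ {xs = words arcs n} M∈)

-- An injection from codes to permutations

map-injective : ∀ {A B : Set} {f : A → B} → (∀ {x y} → f x ≡ f y → x ≡ y) →
                ∀ {n} {u v : Vec A n} → Vec.map f u ≡ Vec.map f v → u ≡ v
map-injective inj {u = []}    {[]}    eq = refl
map-injective inj {u = _ ∷ _} {_ ∷ _} eq =
  cong₂ _∷_ (inj (Vec.∷-injectiveˡ eq)) (map-injective inj (Vec.∷-injectiveʳ eq))

prepend : ∀ {n} → Fin (suc n) → Vec (Fin n) n → Vec (Fin (suc n)) (suc n)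
prepend p v = p ∷ Vec.map (punchIn p) v

prepend-lookup-injective : ∀ {n} p (v : Vec (Fin n) n) → (∀ {i j} → lookup v i ≡ lookup v j → i ≡ j) →
  ∀ {i j} → lookup (prepend p v) i ≡ lookup (prepend p v) j → i ≡ j
prepend-lookup-injective p v inj {zero} {zero} eq = refl
prepend-lookup-injective p v inj {zero} {suc j} eq =
  ⊥-elim (Fin.punchInᵢ≢i p (lookup v j) (sym (trans eq (Vec.lookup-map j (punchIn p) v))))
prepend-lookup-injective p v inj {suc i} {zero} eq =
  ⊥-elim (Fin.punchInᵢ≢i p (lookup v i) (trans (sym (Vec.lookup-map i (punchIn p) v)) eq))
prepend-lookup-injective p v inj {suc i} {suc j} eq =
  cong suc (inj (Fin.punchIn-injective p _ _
    (trans (sym (Vec.lookup-map i (punchIn p) v)) (trans eq (Vec.lookup-map j (punchIn p) v)))))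

prepend-injective : ∀ {n} {p q} {u v : Vec (Fin n) n} → prepend p u ≡ prepend q v → p ≡ q × u ≡ v
prepend-injective {p = p} eq with Vec.∷-injectiveˡ eq
... | refl = refl , map-injective (λ {x} {y} → Fin.punchIn-injective p x y) (Vec.∷-injectiveʳ eq)

-- The inverse of the Lehmer code, with the last letter of `a` giving the first entry: a letter is
-- the number of smaller entries to the right. It serves to bound the number of codes by the number
-- of permutations and is not the correspondence behind the identity.
fromCode : ∀ {n} (a : Fin n → ℕ) → (∀ i → a i ≤ toℕ i) → Vec (Fin n) n
fromCode {zero}  a a≤ = []
fromCode {suc n} a a≤ = prepend
  (fromℕ< (s≤s (ℕ.≤-trans (a≤ (fromℕ n)) (ℕ.≤-reflexive (Fin.toℕ-fromℕ n)))))
  (fromCode (a ∘ inject₁) λ i → ℕ.≤-trans (a≤ (inject₁ i)) (ℕ.≤-reflexive (Fin.toℕ-inject₁ i)))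

fromCode-lookup-injective : ∀ {n} (a : Fin n → ℕ) a≤ {i j} →
  lookup (fromCode a a≤) i ≡ lookup (fromCode a a≤) j → i ≡ j
fromCode-lookup-injective {suc n} a a≤ =
  prepend-lookup-injective _ _ (fromCode-lookup-injective (a ∘ inject₁) _)

fromCode-isPermutation : ∀ {n} (a : Fin n → ℕ) a≤ → IsPermutation (fromCode a a≤)
fromCode-isPermutation a a≤ = inj , λ y → let x , eq = injective⇒surjective inj y in x , λ { refl → eq }
  where
  inj : ∀ {i j} → lookup (fromCode a a≤) i ≡ lookup (fromCode a a≤) j → i ≡ j
  inj = fromCode-lookup-injective a a≤

fromCode-injective : ∀ {n} {a a′ : Fin n → ℕ} {a≤ a′≤} → fromCode a a≤ ≡ fromCode a′ a′≤ → ∀ i → a i ≡ a′ i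
fromCode-injective {suc n} eq i with view i
... | ‵fromℕ     = Fin.fromℕ<-injective _ _ _ _ (proj₁ (prepend-injective eq))
... | ‵inject₁ j = fromCode-injective (proj₂ (prepend-injective eq)) j

-- From codes to matchings

⋖-pred : ∀ {n} {i : Fin n} {k} → k < toℕ i → ∃ λ h → h ⋖ i
⋖-pred {i = suc i} _ = inject₁ i , cong suc (sym (Fin.toℕ-inject₁ i))

⋖⇒< : ∀ {n} {h i : Fin n} → h ⋖ i → toℕ h < toℕ i
⋖⇒< eq = ℕ.≤-reflexive (sym eq)

⋖-unique : ∀ {n} {i j k : Fin n} → i ⋖ k → j ⋖ k → i ≡ j
⋖-unique p q = Fin.toℕ-injective (ℕ.suc-injective (trans (sym p) q))

module Code {n : ℕ} (a : Fin n → ℕ) where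

  Used : Fin n → Set
  Used i = ∃ λ j → a j ≡ toℕ i

  used? : Decidable Used
  used? i = Fin.any? λ j → a j ℕ.≟ toℕ i

  SillyIndex : Fin n → Set
  SillyIndex i = ∃ λ h → h ⋖ i × a i < a h × ¬ Used i

  sillyIndex? : Decidable SillyIndex
  sillyIndex? i = Fin.any? λ h → (h ⋖? i) ×-dec (a i ℕ.<? a h) ×-dec (¬? (used? i))

  -- The order of the openers: by block, then by index.
  _≺_ : Fin n → Fin n → Set
  j ≺ i = a j < a i ⊎ (a j ≡ a i × toℕ j < toℕ i)

  _≺?_ : ∀ j i → Dec (j ≺ i)
  j ≺? i = (a j ℕ.<? a i) ⊎-dec ((a j ℕ.≟ a i) ×-dec (toℕ j ℕ.<? toℕ i))

  before? : ∀ i → Decidable (_≺ i)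
  before? i j = j ≺? i

  atMost? : ∀ (i : Fin n) → Decidable λ j → a j ≤ toℕ i
  atMost? i j = a j ℕ.≤? toℕ i

  -- Each endpoint is placed by counting the endpoints to its left. Before the opener of `i` stand
  -- the first `a i` closers and the openers preceding it; before its closer stand the closers of
  -- smaller index and the openers of the blocks up to `i`.
  opener closer : Fin n → ℕ
  opener i = a i + #[ before? i ]
  closer i = toℕ i + #[ atMost? i ]

  ≺⇒≤ : ∀ {i j} → i ≺ j → a i ≤ a j
  ≺⇒≤ (inj₁ p)       = ℕ.<⇒≤ p
  ≺⇒≤ (inj₂ (p , _)) = ℕ.≤-reflexive p

  ≺-irrefl : ∀ {i} → ¬ i ≺ i
  ≺-irrefl (inj₁ p)       = ℕ.<-irrefl refl p
  ≺-irrefl (inj₂ (_ , p)) = ℕ.<-irrefl refl p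

  ≺-trans : ∀ {i j k} → i ≺ j → j ≺ k → i ≺ k
  ≺-trans (inj₁ p) q                      = inj₁ (ℕ.<-≤-trans p (≺⇒≤ q))
  ≺-trans (inj₂ (p , _)) (inj₁ q)         = inj₁ (ℕ.≤-<-trans (ℕ.≤-reflexive p) q)
  ≺-trans (inj₂ (p , p′)) (inj₂ (q , q′)) = inj₂ (trans p q , ℕ.<-trans p′ q′)

  ≺-compare : ∀ i j → i ≺ j ⊎ i ≡ j ⊎ j ≺ i
  ≺-compare i j with ℕ.<-cmp (a i) (a j)
  ... | tri< p _ _ = inj₁ (inj₁ p)
  ... | tri> _ _ p = inj₂ (inj₂ (inj₁ p))
  ... | tri≈ _ p _ with ℕ.<-cmp (toℕ i) (toℕ j)
  ... | tri< q _ _ = inj₁ (inj₂ (p , q))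
  ... | tri≈ _ q _ = inj₂ (inj₁ (Fin.toℕ-injective q))
  ... | tri> _ _ q = inj₂ (inj₂ (inj₂ (sym p , q)))

  closer-mono : ∀ {i j} → toℕ i < toℕ j → closer i < closer j
  closer-mono {i} {j} i<j = ℕ.+-mono-<-≤ i<j (#-mono (atMost? i) (atMost? j) λ p → ℕ.≤-trans p (ℕ.<⇒≤ i<j))

  opener-mono : ∀ {i j} → i ≺ j → opener i < opener j
  opener-mono {i} {j} i≺j = ℕ.+-mono-≤-< (≺⇒≤ i≺j)
    (#-mono-< (before? i) (before? j) (λ p → ≺-trans p i≺j) i≺j ≺-irrefl)

  closer<opener : ∀ {i j} → toℕ j < a i → closer j < opener i
  closer<opener {i} {j} j<a = ℕ.+-mono-<-≤ j<a
    (#-mono (atMost? j) (before? i) λ p → inj₁ (ℕ.≤-<-trans p j<a))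

  -- Openers that precede that of `i` lie in blocks up to `j`; the inequality is strict because `i`
  -- itself is counted on the right only.
  opener<closer : ∀ {i j} → a i ≤ toℕ j → opener i < closer j
  opener<closer {i} {j} a≤j = ℕ.+-mono-≤-< a≤j
    (#-mono-< (before? i) (atMost? j) (λ p → ℕ.≤-trans (≺⇒≤ p) a≤j) a≤j ≺-irrefl)

  opener≢closer : ∀ i j → opener i ≢ closer j
  opener≢closer i j eq with toℕ j ℕ.<? a i
  ... | yes p = ℕ.<-irrefl (sym eq) (closer<opener p)
  ... | no ¬p = ℕ.<-irrefl eq (opener<closer (ℕ.≮⇒≥ ¬p))

  opener-injective : ∀ {i j} → opener i ≡ opener j → i ≡ j
  opener-injective {i} {j} eq with ≺-compare i j
  ... | inj₁ p        = ⊥-elim (ℕ.<-irrefl eq (opener-mono p))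
  ... | inj₂ (inj₁ p) = p
  ... | inj₂ (inj₂ p) = ⊥-elim (ℕ.<-irrefl (sym eq) (opener-mono p))

  closer-injective : ∀ {i j} → closer i ≡ closer j → i ≡ j
  closer-injective {i} {j} eq with ℕ.<-cmp (toℕ i) (toℕ j)
  ... | tri< p _ _ = ⊥-elim (ℕ.<-irrefl eq (closer-mono p))
  ... | tri≈ _ p _ = Fin.toℕ-injective p
  ... | tri> _ _ p = ⊥-elim (ℕ.<-irrefl (sym eq) (closer-mono p))

  opener-cancel-< : ∀ {i j} → opener i < opener j → i ≺ j
  opener-cancel-< {i} {j} lt with ≺-compare i j
  ... | inj₁ p           = p
  ... | inj₂ (inj₁ refl) = ⊥-elim (ℕ.<-irrefl refl lt)
  ... | inj₂ (inj₂ p)    = ⊥-elim (ℕ.<-asym lt (opener-mono p))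

  closer-cancel-< : ∀ {i j} → closer i < closer j → toℕ i < toℕ j
  closer-cancel-< {i} {j} lt with ℕ.<-cmp (toℕ i) (toℕ j)
  ... | tri< p _ _ = p
  ... | tri≈ _ p _ = ⊥-elim (ℕ.<-irrefl (cong closer (Fin.toℕ-injective p)) lt)
  ... | tri> _ _ p = ⊥-elim (ℕ.<-asym lt (closer-mono p))

  opener-closer-cancel-< : ∀ {i j} → opener i < closer j → a i ≤ toℕ j
  opener-closer-cancel-< {i} {j} lt with toℕ j ℕ.<? a i
  ... | yes p = ⊥-elim (ℕ.<-asym lt (closer<opener p))
  ... | no ¬p = ℕ.≮⇒≥ ¬p

  -- The points between the closers of `h` and `i` are the openers of block `i`, and this block is
  -- empty when `i` is not a value of `a`.
  closer-⋖⁺ : ∀ {h i} → h ⋖ i → ¬ Used i → closer i ≡ suc (closer h)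
  closer-⋖⁺ {h} {i} h⋖i ¬u = cong₂ _+_ h⋖i (#-ext (atMost? i) (atMost? h)
    (λ {j} p → s≤s⁻¹ (ℕ.≤-trans (ℕ.≤∧≢⇒< p λ eq → ¬u (j , eq)) (ℕ.≤-reflexive h⋖i)))
    (λ p → ℕ.≤-trans p (ℕ.<⇒≤ (⋖⇒< h⋖i))))

  closer-⋖⁻ : ∀ {h i} → h ⋖ i → closer i ≡ suc (closer h) → ¬ Used i
  closer-⋖⁻ {h} {i} h⋖i eq (j , aj≡i) = ℕ.<-irrefl (sym eq) (ℕ.+-mono-≤-< {x = suc (toℕ h)} (⋖⇒< h⋖i)
    (#-mono-< (atMost? h) (atMost? i) (λ p → ℕ.≤-trans p (ℕ.<⇒≤ (⋖⇒< h⋖i))) {j} (ℕ.≤-reflexive aj≡i)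
       λ p → ℕ.<-irrefl aj≡i (ℕ.≤-<-trans p (⋖⇒< h⋖i))))

infix 4 _codedBy_

-- A relation on endpoints, because it is reached from both sides: from a code by `codedMatching`,
-- and from a matching by `isMatching⇒codedBy`.
_codedBy_ : ∀ {n} → Vec (Arc (2 ℕ.* n)) n → (Fin n → ℕ) → Set
M codedBy a = ∀ i → toℕ (op (lookup M i)) ≡ Code.opener a i × toℕ (cl (lookup M i)) ≡ Code.closer a i

module _ {n : ℕ} {a : Fin n → ℕ} (a≤ : ∀ i → a i ≤ toℕ i) where
  open Code a

  private
    n+n≤2*n : n + n ≤ 2 ℕ.* n
    n+n≤2*n = ℕ.≤-reflexive (cong (n +_) (sym (ℕ.+-identityʳ n)))

    #≤n : ∀ i → #[ atMost? i ] ≤ n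
    #≤n i = ℕ.≤-trans (#-mono (atMost? i) (λ _ → yes tt) λ _ → tt) (ℕ.≤-reflexive (#-full n))

    closer< : ∀ i → closer i < 2 ℕ.* n
    closer< i = ℕ.<-≤-trans (ℕ.+-mono-<-≤ (Fin.toℕ<n i) (#≤n i)) n+n≤2*n

    opener< : ∀ i → opener i < 2 ℕ.* n
    opener< i = ℕ.<-trans (opener<closer {i} (a≤ i)) (closer< i)

  codedMatching : ∃ λ M → M codedBy a
  codedMatching = Vec.tabulate arc , λ i →
    trans (cong (toℕ ∘ op) (Vec.lookup∘tabulate arc i)) (Fin.toℕ-fromℕ< (opener< i)) ,
    trans (cong (toℕ ∘ cl) (Vec.lookup∘tabulate arc i)) (Fin.toℕ-fromℕ< (closer< i))
    where
    arc : Fin n → Arc (2 ℕ.* n)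
    arc i = fromℕ< (opener< i) , fromℕ< (closer< i)

  module _ {M : Vec (Arc (2 ℕ.* n)) n} (coded : M codedBy a) where

    private
      op≡ : ∀ i → toℕ (op (lookup M i)) ≡ opener i
      op≡ i = proj₁ (coded i)

      cl≡ : ∀ i → toℕ (cl (lookup M i)) ≡ closer i
      cl≡ i = proj₂ (coded i)

      Endpoint : Fin n ⊎ Fin n → Fin (2 ℕ.* n) → Set
      Endpoint (inj₁ i) q = q ≡ op (lookup M i)
      Endpoint (inj₂ i) q = q ≡ cl (lookup M i)

      Endpoint-injective : ∀ {s s′ q} → Endpoint s q → Endpoint s′ q → s ≡ s′
      Endpoint-injective {inj₁ i} {inj₁ j} p q =
        cong inj₁ (opener-injective (trans (sym (op≡ i)) (trans (cong toℕ (trans (sym p) q)) (op≡ j))))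
      Endpoint-injective {inj₁ i} {inj₂ j} p q =
        ⊥-elim (opener≢closer i j (trans (sym (op≡ i)) (trans (cong toℕ (trans (sym p) q)) (cl≡ j))))
      Endpoint-injective {inj₂ i} {inj₁ j} p q =
        ⊥-elim (opener≢closer j i (trans (sym (op≡ j)) (trans (cong toℕ (trans (sym q) p)) (cl≡ i))))
      Endpoint-injective {inj₂ i} {inj₂ j} p q =
        cong inj₂ (closer-injective (trans (sym (cl≡ i)) (trans (cong toℕ (trans (sym p) q)) (cl≡ j))))

      index : Fin n ⊎ Fin n → Fin n
      index = [ id , id ]′

      -- The endpoints of the `n` arcs are distinct, so by counting they fill `Fin (2 * n)`.
      cover : ∀ q → ∃ λ s → Endpoint s q
      cover q with #-+-surjective (λ (_ : Fin n) → yes tt) (λ (_ : Fin n) → yes tt) (λ (_ : Fin (2 ℕ.* n)) → yes tt)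
                     Endpoint
                     (λ { (inj₁ i) _ → _ , tt , refl ; (inj₂ i) _ → _ , tt , refl })
                     (λ {s} {s′} _ _ → Endpoint-injective {s} {s′})
                     (ℕ.≤-reflexive (trans (#-full (2 ℕ.* n))
                       (trans (cong (n +_) (ℕ.+-identityʳ n)) (sym (cong₂ _+_ (#-full n) (#-full n))))))
                     {q} tt
      ... | s , _ , e = s , e

      endpoint : ∀ {q i} → q ≡ op (lookup M i) ⊎ q ≡ cl (lookup M i) → ∃ λ s → Endpoint s q × index s ≡ i
      endpoint (inj₁ p) = inj₁ _ , p , refl
      endpoint (inj₂ p) = inj₂ _ , p , refl

      unendpoint : ∀ s {q} → Endpoint s q → q ≡ op (lookup M (index s)) ⊎ q ≡ cl (lookup M (index s))
      unendpoint (inj₁ i) p = inj₁ p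
      unendpoint (inj₂ i) p = inj₂ p

    codedBy⇒isMatching : IsMatching M
    codedBy⇒isMatching =
      (λ i → subst₂ _<_ (sym (op≡ i)) (sym (cl≡ i)) (opener<closer (a≤ i))) ,
      (λ i j i<j → subst₂ _<_ (sym (cl≡ i)) (sym (cl≡ j)) (closer-mono i<j)) ,
      (λ q → let s , e = cover q in index s , unendpoint s e , λ e′ →
         let s′ , e″ , eq = endpoint e′ in trans (cong index (Endpoint-injective {s} {s′} e e″)) eq)

    -- If op(B) = op(A) ∸ 1 and cl(A) < cl(B), then A lies in a later block
    -- than B, and the closer ending the block of op(B) separates the openers.
    codedBy⇒noLeftNesting : NoLeftNesting M
    codedBy⇒noLeftNesting i j (oj<oi , _ , ci<cj , oj⋖oi)
      with opener-cancel-< (subst₂ _<_ (op≡ j) (op≡ i) oj<oi)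
    ... | inj₂ (_ , j<i) = ℕ.<-asym j<i (closer-cancel-< (subst₂ _<_ (cl≡ i) (cl≡ j) ci<cj))
    ... | inj₁ aj<ai = ℕ.<-irrefl refl (begin-strict
      suc (opener j)  ≤⟨ opener<closer (ℕ.≤-reflexive (sym (Fin.toℕ-fromℕ< aj<n))) ⟩
      closer k        <⟨ closer<opener (subst (_< a i) (sym (Fin.toℕ-fromℕ< aj<n)) aj<ai) ⟩
      opener i        ≡⟨ op≡ i ⟨
      toℕ (op (lookup M i)) ≡⟨ oj⋖oi ⟩
      suc (toℕ (op (lookup M j))) ≡⟨ cong suc (op≡ j) ⟩
      suc (opener j)  ∎)
      where
      open ℕ.≤-Reasoning
      aj<n : a j < n
      aj<n = ℕ.≤-<-trans (a≤ j) (Fin.toℕ<n j)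
      k : Fin n
      k = fromℕ< aj<n

    codedBy⇒min : min M ≡ #[ (λ i → a i ℕ.≟ 0) ]
    codedBy⇒min = #-ext (opensBeforeFirstCloser? M) (λ i → a i ℕ.≟ 0)
      (λ {i} (h , h≡0 , lt) → ℕ.n≤0⇒n≡0 (subst (a i ≤_) h≡0
        (opener-closer-cancel-< (subst₂ _<_ (op≡ i) (cl≡ h) lt))))
      (λ {i} a≡0 → let 0<n = ℕ.≤-<-trans z≤n (Fin.toℕ<n i) in
        fromℕ< 0<n , Fin.toℕ-fromℕ< 0<n ,
        subst₂ _<_ (sym (op≡ i)) (sym (cl≡ _)) (opener<closer (ℕ.≤-trans (ℕ.≤-reflexive a≡0) z≤n)))

    private
      continuesRun⁺ : ∀ {h i} → h ⋖ i → ¬ Used i → cl (lookup M h) ⋖ cl (lookup M i)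
      continuesRun⁺ {h} {i} h⋖i ¬u = trans (cl≡ i) (trans (closer-⋖⁺ h⋖i ¬u) (cong suc (sym (cl≡ h))))

      continuesRun⁻ : ∀ {h i} → h ⋖ i → cl (lookup M h) ⋖ cl (lookup M i) → ¬ Used i
      continuesRun⁻ {h} {i} h⋖i eq = closer-⋖⁻ h⋖i (trans (sym (cl≡ i)) (trans eq (cong suc (cl≡ h))))

    codedBy⇒rne : rne M ≡ #[ sillyIndex? ]
    codedBy⇒rne = #-ext (isRightNesting? M) sillyIndex?
      (λ {i} (h , h⋖i , oi<oh , _ , ch⋖ci) → h , h⋖i ,
        -- Inside a block openers follow the indices, so an opener of `i` to the left of that of its
        -- predecessor `h` must lie in a strictly earlier block.
        (case opener-cancel-< (subst₂ _<_ (op≡ i) (op≡ h) oi<oh) of λ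
          { (inj₁ p) → p ; (inj₂ (_ , p)) → ⊥-elim (ℕ.<-asym p (⋖⇒< h⋖i)) }) ,
        continuesRun⁻ h⋖i ch⋖ci)
      (λ {i} (h , h⋖i , ai<ah , ¬u) → h , h⋖i ,
        subst₂ _<_ (sym (op≡ i)) (sym (op≡ h)) (opener-mono (inj₁ ai<ah)) ,
        subst₂ _<_ (sym (op≡ h)) (sym (cl≡ h)) (opener<closer (a≤ h)) ,
        continuesRun⁺ h⋖i ¬u)

    -- Every index either continues a run of closers or is a value of `a`, and never both.
    codedBy⇒int : int M ≡ #[ used? ]
    codedBy⇒int = trans (cong (_∸ #[ continuesRun? M ]) (sym split)) (ℕ.m+n∸m≡n #[ continuesRun? M ] #[ used? ])
      where
      I : Fin n ⊎ Fin n → Fin n → Set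
      I s k = index s ≡ k
      split : #[ continuesRun? M ] + #[ used? ] ≡ n
      split = trans (#-+ (continuesRun? M) used? (λ _ → yes tt) I
        (λ s _ → index s , tt , refl)
        (λ { {inj₁ i} {inj₁ j} _ _ refl refl → refl
           ; {inj₂ i} {inj₂ j} _ _ refl refl → refl
           ; {inj₁ i} {inj₂ j} (h , h⋖i , c) u refl refl → ⊥-elim (continuesRun⁻ h⋖i c u)
           ; {inj₂ i} {inj₁ j} u (h , h⋖i , c) refl refl → ⊥-elim (continuesRun⁻ h⋖i c u) })
        (λ {k} _ → case used? k of λ
          { (yes u) → inj₂ k , u , refl
          ; (no ¬u) → let h , h⋖k = ⋖-pred (0<k ¬u) in inj₁ k , (h , h⋖k , continuesRun⁺ h⋖k ¬u) , refl })
        (λ _ _ p q → trans (sym p) q))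
        (#-full n)
        where
        -- The bound `a 0 ≤ 0` makes 0 a value, so an index that is not a value has a predecessor.
        0<k : ∀ {k} → ¬ Used k → 0 < toℕ k
        0<k {k} ¬u = ℕ.n≢0⇒n>0 λ k≡0 → ¬u (k , trans (ℕ.n≤0⇒n≡0 (subst (a k ≤_) k≡0 (a≤ k))) (sym k≡0))

-- The letter `a i` is the least index of a closer to the right of the opener of `i`. Since the
-- closer of index `a′ i` is to the right of that opener, `a i ≤ a′ i`, and the converse is
-- symmetric.
codedBy-injective : ∀ {n} {M : Vec (Arc (2 ℕ.* n)) n} {a a′ : Fin n → ℕ} →
  (∀ i → a i ≤ toℕ i) → (∀ i → a′ i ≤ toℕ i) → M codedBy a → M codedBy a′ → ∀ i → a i ≡ a′ i
codedBy-injective {n} {M} a≤ a′≤ c c′ i = ℕ.≤-antisym (go {M} a′≤ c c′) (go {M} a≤ c′ c)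
  where
  go : ∀ {M : Vec (Arc (2 ℕ.* n)) n} {a a′ : Fin n → ℕ} → (∀ i → a′ i ≤ toℕ i) →
       M codedBy a → M codedBy a′ → a i ≤ a′ i
  go {a = a} {a′} a′≤ c c′ = subst (a i ≤_) (Fin.toℕ-fromℕ< a′<n)
    (Code.opener-closer-cancel-< a (subst₂ _<_ (proj₁ (c i)) (proj₂ (c k))
      (subst₂ _<_ (sym (proj₁ (c′ i))) (sym (proj₂ (c′ k)))
        (Code.opener<closer a′ (ℕ.≤-reflexive (sym (Fin.toℕ-fromℕ< a′<n)))))))
    where
    a′<n : a′ i < n
    a′<n = ℕ.≤-<-trans (a′≤ i) (Fin.toℕ<n i)
    k : Fin n
    k = fromℕ< a′<n

codedBy-unique : ∀ {n} {M M′ : Vec (Arc (2 ℕ.* n)) n} {a a′ : Fin n → ℕ} → (∀ i → a i ≡ a′ i) →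
  M codedBy a → M′ codedBy a′ → M ≡ M′
codedBy-unique {n} {a = a} {a′} eq c c′ = lookup-ext λ i → cong₂ _,_
  (Fin.toℕ-injective (trans (proj₁ (c i)) (trans (opener-cong i) (sym (proj₁ (c′ i))))))
  (Fin.toℕ-injective (trans (proj₂ (c i)) (trans (closer-cong i) (sym (proj₂ (c′ i))))))
  where
  opener-cong : ∀ i → Code.opener a i ≡ Code.opener a′ i
  opener-cong i = cong₂ _+_ (eq i) (#-ext (Code.before? a i) (Code.before? a′ i)
    (λ {j} → Sum.map (subst₂ _<_ (eq j) (eq i)) λ (p , q) → trans (sym (eq j)) (trans p (eq i)) , q)
    (λ {j} → Sum.map (subst₂ _<_ (sym (eq j)) (sym (eq i))) λ (p , q) → trans (eq j) (trans p (sym (eq i))) , q))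
  closer-cong : ∀ i → Code.closer a i ≡ Code.closer a′ i
  closer-cong i = cong (toℕ i +_) (#-ext (Code.atMost? a i) (Code.atMost? a′ i)
    (λ {j} → subst (_≤ toℕ i) (eq j)) (λ {j} → subst (_≤ toℕ i) (sym (eq j))))

-- From matchings to codes

module _ {n : ℕ} (M : Vec (Arc (2 ℕ.* n)) n) (matching : IsMatching M) (noLeftNesting : NoLeftNesting M) where

  private
    o c : Fin n → ℕ
    o i = toℕ (op (lookup M i))
    c i = toℕ (cl (lookup M i))

    o<c : ∀ i → o i < c i
    o<c = proj₁ matching

    c-mono : ∀ {i j} → toℕ i < toℕ j → c i < c j
    c-mono = proj₁ (proj₂ matching) _ _

    arcAt : ∀ q → ∃! _≡_ λ i → q ≡ op (lookup M i) ⊎ q ≡ cl (lookup M i)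
    arcAt = proj₂ (proj₂ matching)

    sameArc : ∀ {q i j} → q ≡ op (lookup M i) ⊎ q ≡ cl (lookup M i) → q ≡ op (lookup M j) ⊎ q ≡ cl (lookup M j) → i ≡ j
    sameArc {q} p p′ = let _ , _ , uniq = arcAt q in trans (sym (uniq p)) (uniq p′)

    o-injective : ∀ {i j} → o i ≡ o j → i ≡ j
    o-injective eq = sameArc (inj₁ refl) (inj₁ (Fin.toℕ-injective eq))

    o≢c : ∀ i j → o i ≢ c j
    o≢c i j eq with sameArc {i = i} {j} (inj₁ refl) (inj₂ (Fin.toℕ-injective eq))
    ... | refl = ℕ.<-irrefl eq (o<c i)

    c-mono-≤ : ∀ {i j} → toℕ i ≤ toℕ j → c i ≤ c j
    c-mono-≤ i≤j with ℕ.m≤n⇒m<n∨m≡n i≤j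
    ... | inj₁ i<j = ℕ.<⇒≤ (c-mono i<j)
    ... | inj₂ i≡j = ℕ.≤-reflexive (cong c (Fin.toℕ-injective i≡j))

    c-cancel-< : ∀ {i j} → c i < c j → toℕ i < toℕ j
    c-cancel-< lt = ℕ.≰⇒> λ j≤i → ℕ.<⇒≱ lt (c-mono-≤ j≤i)

    opBefore? : ∀ k → Decidable λ (j : Fin n) → o j < k
    opBefore? k j = o j ℕ.<? k

    clBefore? : ∀ k → Decidable λ (j : Fin n) → c j < k
    clBefore? k j = c j ℕ.<? k

    a : Fin n → ℕ
    a i = #[ clBefore? (o i) ]

    open Code a using (_≺_; before?; atMost?; ≺-compare)

    -- Closers increase with the index, so the `a i` closers to the left of the opener of `i` are
    -- precisely those of index below `a i`; `c<o⁺` is the other half.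
    c<o⁻ : ∀ {i j} → c j < o i → toℕ j < a i
    c<o⁻ {i} {j} cj<oi = subst (_≤ a i) (#-below {n} (suc (toℕ j)) (Fin.toℕ<n j))
      (#-mono (λ (l : Fin n) → toℕ l ℕ.<? suc (toℕ j)) (clBefore? (o i)) λ l≤j → ℕ.≤-<-trans (c-mono-≤ (s≤s⁻¹ l≤j)) cj<oi)

    c<o⁺ : ∀ {i j} → toℕ j < a i → c j < o i
    c<o⁺ {i} {j} j<a = ℕ.≰⇒> λ oi≤cj → ℕ.<⇒≱ j<a (subst (a i ≤_) (#-below {n} (toℕ j) (ℕ.<⇒≤ (Fin.toℕ<n j)))
      (#-mono (clBefore? (o i)) (λ (l : Fin n) → toℕ l ℕ.<? toℕ j) λ cl<oi → c-cancel-< (ℕ.<-≤-trans cl<oi oi≤cj)))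

    a≤ : ∀ i → a i ≤ toℕ i
    a≤ i = ℕ.≮⇒≥ λ i<a → ℕ.<-asym (o<c i) (c<o⁺ i<a)

    -- Every point below `q` is an endpoint of exactly one arc. This brings a position into the form
    -- used for `opener` and `closer`, a number of openers plus a number of closers.
    points : ∀ q → #[ opBefore? (toℕ q) ] + #[ clBefore? (toℕ q) ] ≡ toℕ q
    points q = trans
      (#-+ (opBefore? (toℕ q)) (clBefore? (toℕ q)) (λ (p : Fin (2 ℕ.* n)) → toℕ p ℕ.<? toℕ q) E
        (λ { (inj₁ i) lt → _ , lt , refl ; (inj₂ i) lt → _ , lt , refl })
        (λ { {inj₁ i} {inj₁ j} _ _ p p′ → cong inj₁ (o-injective (cong toℕ (trans (sym p) p′)))
           ; {inj₁ i} {inj₂ j} _ _ p p′ → ⊥-elim (o≢c i j (cong toℕ (trans (sym p) p′)))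
           ; {inj₂ i} {inj₁ j} _ _ p p′ → ⊥-elim (o≢c j i (cong toℕ (trans (sym p′) p)))
           ; {inj₂ i} {inj₂ j} _ _ p p′ → cong inj₂ (sameArc (inj₂ p) (inj₂ p′)) })
        (λ {p} lt → let i , e , _ = arcAt p in
          [ (λ eq → inj₁ i , subst (λ x → toℕ x < toℕ q) eq lt , eq)
          , (λ eq → inj₂ i , subst (λ x → toℕ x < toℕ q) eq lt , eq) ]′ e)
        (λ { {inj₁ i} _ _ p p′ → trans p (sym p′) ; {inj₂ i} _ _ p p′ → trans p (sym p′) }))
      (#-below {2 ℕ.* n} (toℕ q) (ℕ.<⇒≤ (Fin.toℕ<n q)))
      where
      E : Fin n ⊎ Fin n → Fin (2 ℕ.* n) → Set
      E (inj₁ i) p = p ≡ op (lookup M i)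
      E (inj₂ i) p = p ≡ cl (lookup M i)

    -- With the indices, and hence the closers, in the opposite order, the two arcs would form a
    -- left nesting.
    adjacent : ∀ {i j} → o j ≡ suc (o i) → toℕ i < toℕ j
    adjacent {i} {j} eq with ℕ.<-cmp (toℕ i) (toℕ j)
    ... | tri< p _ _ = p
    ... | tri≈ _ p _ = ⊥-elim (ℕ.m≢1+n+m (o i) (trans (cong o (Fin.toℕ-injective p)) eq))
    ... | tri> _ _ p = ⊥-elim (noLeftNesting j i (ℕ.≤-reflexive (sym eq) , o<c j , c-mono p , eq))

    -- Openers not separated by a closer are consecutive, so the absence of
    -- left nestings applies to each adjacent pair of them.
    chain : ∀ d {i j} → o j ≡ suc d + o i → (∀ l → o i < c l → ¬ c l < o j) → toℕ i < toℕ j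
    chain zero eq _ = adjacent eq
    chain (suc d) {i} {j} eq none = go (arcAt q)
      where
      q< : suc (o i) < 2 ℕ.* n
      q< = ℕ.<-trans (ℕ.≤-trans (s≤s (s≤s (ℕ.m≤n+m (o i) d))) (ℕ.≤-reflexive (sym eq))) (Fin.toℕ<n (op (lookup M j)))
      q : Fin (2 ℕ.* n)
      q = fromℕ< q<
      toℕ-q : toℕ q ≡ suc (o i)
      toℕ-q = Fin.toℕ-fromℕ< q<
      go : (∃! _≡_ λ k → q ≡ op (lookup M k) ⊎ q ≡ cl (lookup M k)) → toℕ i < toℕ j
      go (k , inj₁ q≡o , _) = ℕ.<-trans (adjacent ok≡) (chain d
        (trans eq (trans (cong suc (sym (ℕ.+-suc d (o i)))) (cong (suc d +_) (sym ok≡))))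
        λ l lt → none l (ℕ.<-trans (ℕ.≤-reflexive (sym ok≡)) lt))
        where
        ok≡ : o k ≡ suc (o i)
        ok≡ = trans (cong toℕ (sym q≡o)) toℕ-q
      go (k , inj₂ q≡c , _) = ⊥-elim (none k (ℕ.≤-reflexive (sym ck≡))
        (ℕ.≤-trans (s≤s (ℕ.≤-reflexive ck≡)) (ℕ.≤-trans (s≤s (s≤s (ℕ.m≤n+m (o i) d))) (ℕ.≤-reflexive (sym eq)))))
        where
        ck≡ : c k ≡ suc (o i)
        ck≡ = trans (cong toℕ (sym q≡c)) toℕ-q

    o-mono : ∀ {i j} → i ≺ j → o i < o j
    -- The closer of index `a i` separates the two openers.
    o-mono {i} {j} (inj₁ ai<aj) = ℕ.≤-<-trans
      (ℕ.≮⇒≥ λ ck<oi → ℕ.<-irrefl (Fin.toℕ-fromℕ< ai<n) (c<o⁻ ck<oi))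
      (c<o⁺ {j} (subst (_< a j) (sym (Fin.toℕ-fromℕ< ai<n)) ai<aj))
      where
      ai<n : a i < n
      ai<n = ℕ.≤-<-trans (a≤ i) (Fin.toℕ<n i)
    o-mono {i} {j} (inj₂ (ai≡aj , i<j)) with ℕ.<-cmp (o i) (o j)
    ... | tri< p _ _ = p
    ... | tri≈ _ p _ = ⊥-elim (ℕ.<-irrefl (cong toℕ (o-injective p)) i<j)
    -- No closer separates openers with equal letters, so the wrong order would let `chain` put `j`
    -- before `i`.
    ... | tri> _ _ p = ⊥-elim (ℕ.<-asym i<j (chain (o i ∸ suc (o j))
      (sym (trans (cong suc (ℕ.+-comm (o i ∸ suc (o j)) (o j))) (ℕ.m+[n∸m]≡n p)))
      λ l oj<cl cl<oi → ℕ.<-asym oj<cl (c<o⁺ (subst (toℕ l <_) ai≡aj (c<o⁻ cl<oi)))))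

    o-cancel-< : ∀ {i j} → o i < o j → i ≺ j
    o-cancel-< {i} {j} lt with ≺-compare i j
    ... | inj₁ p           = p
    ... | inj₂ (inj₁ refl) = ⊥-elim (ℕ.<-irrefl refl lt)
    ... | inj₂ (inj₂ p)    = ⊥-elim (ℕ.<-asym lt (o-mono p))

    coded : M codedBy a
    coded i =
      trans (sym (points (op (lookup M i)))) (trans
        (ℕ.+-comm #[ opBefore? (o i) ] (a i))
        (cong (a i +_) (#-ext (opBefore? (o i)) (before? i) o-cancel-< o-mono))) ,
      trans (sym (points (cl (lookup M i)))) (trans
        (ℕ.+-comm #[ opBefore? (c i) ] #[ clBefore? (c i) ])
        (cong₂ _+_
          (trans (#-ext (clBefore? (c i)) (λ (l : Fin n) → toℕ l ℕ.<? toℕ i) c-cancel-< c-mono)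
                 (#-below {n} (toℕ i) (ℕ.<⇒≤ (Fin.toℕ<n i))))
          (#-ext (opBefore? (c i)) (atMost? i)
            (λ oj<ci → ℕ.≮⇒≥ λ i<aj → ℕ.<-asym oj<ci (c<o⁺ i<aj))
            (λ {j} aj≤i → ℕ.≤∧≢⇒< (ℕ.≮⇒≥ λ ci<oj → ℕ.<⇒≱ (c<o⁻ ci<oj) aj≤i) (o≢c j i)))))

  isMatching⇒codedBy : ∃ λ a → (∀ i → a i ≤ toℕ i) × M codedBy a
  isMatching⇒codedBy = a , a≤ , coded

-- Reading off the code of a matching and applying `fromCode` is injective. Together with the
-- injection from permutations to matchings that preserves the statistics, this bound makes the
-- latter a bijection.
length-𝒩≤length-𝒮 : ∀ n → List.length (𝒩 n) ≤ List.length (𝒮 n)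
length-𝒩≤length-𝒮 n = length-≤ {R = R} 𝒩-unique total injective
  where
  R : Vec (Arc (2 ℕ.* n)) n → Vec (Fin n) n → Set
  R M π = ∃ λ a → ∃ λ (a≤ : ∀ i → a i ≤ toℕ i) → M codedBy a × π ≡ fromCode a a≤
  total : Total R (𝒩 n) (𝒮 n)
  total {M} M∈ = let m , l = ∈-𝒩⁻ M∈ ; a , a≤ , coded = isMatching⇒codedBy M m l in
    fromCode a a≤ , ∈-𝒮⁺ (fromCode-isPermutation a a≤) , a , a≤ , coded , refl
  injective : InjectiveOn R (𝒩 n)
  injective _ _ (a , a≤ , coded , eq) (a′ , a′≤ , coded′ , eq′) =
    codedBy-unique (fromCode-injective (trans (sym eq) eq′)) coded coded′

-- Ranks

module _ {N : ℕ} {Z : Pred (Fin N) 0ℓ} (Z? : Decidable Z) where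

  below? : (μ : Fin N → ℕ) → ∀ z → Decidable λ y → Z y × μ y < μ z
  below? μ z y = Z? y ×-dec (μ y ℕ.<? μ z)

  abstract
    rank : (Fin N → ℕ) → Fin N → ℕ
    rank μ z = #[ below? μ z ]

    rank-def : ∀ μ z → rank μ z ≡ #[ below? μ z ]
    rank-def μ z = refl

  rank-mono-< : ∀ μ {y z} → Z y → μ y < μ z → rank μ y < rank μ z
  rank-mono-< μ {y} {z} Zy lt = subst₂ _<_ (sym (rank-def μ y)) (sym (rank-def μ z)) $
    #-mono-< (below? μ y) (below? μ z) (λ (p , q) → p , ℕ.<-trans q lt) {y} (Zy , lt) λ (_ , p) → ℕ.<-irrefl refl p

  rank-cancel-< : ∀ μ {y z} → rank μ y < rank μ z → μ y < μ z
  rank-cancel-< μ {y} {z} lt = ℕ.≰⇒> λ z≤y → ℕ.<⇒≱ lt (subst₂ _≤_ (sym (rank-def μ z)) (sym (rank-def μ y))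
    (#-mono (below? μ z) (below? μ y) λ (p , q) → p , ℕ.<-≤-trans q z≤y))

  rank-injective : ∀ {μ} → (∀ {y z} → μ y ≡ μ z → y ≡ z) → ∀ {y z} → Z y → Z z → rank μ y ≡ rank μ z → y ≡ z
  rank-injective {μ} inj {y} {z} Zy Zz eq with ℕ.<-cmp (μ y) (μ z)
  ... | tri< p _ _ = ⊥-elim (ℕ.<-irrefl eq (rank-mono-< μ Zy p))
  ... | tri≈ _ p _ = inj p
  ... | tri> _ _ p = ⊥-elim (ℕ.<-irrefl (sym eq) (rank-mono-< μ Zz p))

  rank<# : ∀ μ {z} → Z z → rank μ z < #[ Z? ]
  rank<# μ {z} Zz = subst (_< #[ Z? ]) (sym (rank-def μ z)) $ #-mono-< (below? μ z) Z? proj₁ Zz λ (_ , p) → ℕ.<-irrefl refl p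

  -- Distinct keys give distinct ranks, all below the size of the set, so by counting every number
  -- below that size is a rank.
  rank-surjective : ∀ {μ} → (∀ {y z} → μ y ≡ μ z → y ≡ z) → ∀ {k} → k < #[ Z? ] → ∃ λ z → Z z × rank μ z ≡ k
  rank-surjective {μ} inj {k} k<# =
    let z , Zz , eq = #-surjective Z? (λ (i : Fin N) → toℕ i ℕ.<? #[ Z? ]) (λ z i → rank μ z ≡ toℕ i)
          (λ {z} Zz → let lt = ℕ.<-≤-trans (rank<# μ Zz) #≤N in
            fromℕ< lt , subst (_< #[ Z? ]) (sym (Fin.toℕ-fromℕ< lt)) (rank<# μ Zz) , sym (Fin.toℕ-fromℕ< lt))
          (λ Zy Zz p q → rank-injective inj Zy Zz (trans p (sym q)))
          (ℕ.≤-reflexive (#-below #[ Z? ] #≤N))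
          {fromℕ< k<N} (subst (_< #[ Z? ]) (sym (Fin.toℕ-fromℕ< k<N)) k<#)
    in z , Zz , trans eq (Fin.toℕ-fromℕ< k<N)
    where
    #≤N : #[ Z? ] ≤ N
    #≤N = ℕ.≤-trans (#-mono Z? (λ _ → yes tt) λ _ → tt) (ℕ.≤-reflexive (#-full N))
    k<N : k < N
    k<N = ℕ.<-≤-trans k<# #≤N

rank-ext : ∀ {N} {Z Z′ : Pred (Fin N) 0ℓ} (Z? : Decidable Z) (Z′? : Decidable Z′) {μ μ′ z z′} →
  (∀ {y} → Z y × μ y < μ z → Z′ y × μ′ y < μ′ z′) → (∀ {y} → Z′ y × μ′ y < μ′ z′ → Z y × μ y < μ z) →
  rank Z? μ z ≡ rank Z′? μ′ z′
rank-ext Z? Z′? {μ} {μ′} {z} {z′} f g = trans (rank-def Z? μ z) (trans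
  (#-ext (below? Z? μ z) (below? Z′? μ′ z′) f g) (sym (rank-def Z′? μ′ z′)))

-- Runs

record IsRun (n : ℕ) (U : ℕ → Set) (p q : ℕ) : Set where
  field
    q<n     : q < n
    used    : U p
    unused  : ∀ {k} → p < k → k ≤ q → ¬ U k
    maximal : suc q < n → U (suc q)

open IsRun

-- If one run through `v` started later, its start would be a value in the interior of the other; if
-- one ended earlier, the value after its end would be. Two equivalent predicates are allowed so
-- that the runs of two codes can be compared.
run-unique : ∀ {n U U′ p p′ q q′ v} → (∀ {k} → U k → U′ k) → (∀ {k} → U′ k → U k) →
  IsRun n U p q → p ≤ v → v ≤ q → IsRun n U′ p′ q′ → p′ ≤ v → v ≤ q′ → p ≡ p′ × q ≡ q′
run-unique {n} f g r p≤v v≤q r′ p′≤v v≤q′ =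
  ℕ.≤-antisym (start f r v≤q p≤v r′ p′≤v v≤q′) (start g r′ v≤q′ p′≤v r p≤v v≤q) ,
  ℕ.≤-antisym (end g r p≤v v≤q r′ p′≤v v≤q′) (end f r′ p′≤v v≤q′ r p≤v v≤q)
  where
  start : ∀ {U U′ : ℕ → Set} {p p′ q q′ v} → (∀ {k} → U k → U′ k) → IsRun n U p q → v ≤ q → p ≤ v →
          IsRun n U′ p′ q′ → p′ ≤ v → v ≤ q′ → p ≤ p′
  start f r v≤q p≤v r′ p′≤v v≤q′ = ℕ.≮⇒≥ λ p′<p → unused r′ p′<p (ℕ.≤-trans p≤v v≤q′) (f (used r))
  end : ∀ {U U′ : ℕ → Set} {p p′ q q′ v} → (∀ {k} → U′ k → U k) → IsRun n U p q → p ≤ v → v ≤ q →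
        IsRun n U′ p′ q′ → p′ ≤ v → v ≤ q′ → q ≤ q′
  end g r p≤v v≤q r′ p′≤v v≤q′ = ℕ.≮⇒≥ λ q′<q →
    unused r (s≤s (ℕ.≤-trans p≤v v≤q′)) q′<q (g (maximal r′ (ℕ.≤-<-trans q′<q (q<n r))))

module _ {n : ℕ} {U : ℕ → Set} (U? : Decidable U) (U0 : 0 < n → U 0) where

  private
    findStart : U 0 → ∀ v → ∃ λ p → p ≤ v × U p × (∀ {k} → p < k → k ≤ v → ¬ U k)
    findStart u zero = 0 , z≤n , u , λ p<k k≤0 → ⊥-elim (ℕ.<⇒≱ p<k k≤0)
    findStart u (suc v) with U? (suc v)
    ... | yes u′ = suc v , ℕ.≤-refl , u′ , λ p<k k≤v → ⊥-elim (ℕ.<⇒≱ p<k k≤v)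
    ... | no ¬u  with findStart u v
    ... | p , p≤v , u′ , none = p , ℕ.m≤n⇒m≤1+n p≤v , u′ , λ {k} p<k k≤1+v →
      case ℕ.m≤n⇒m<n∨m≡n k≤1+v of λ { (inj₁ k<1+v) → none p<k (s≤s⁻¹ k<1+v) ; (inj₂ refl) → ¬u }

    -- The number `d` of indices to the right of `v` bounds the search.
    findEnd : ∀ d v → suc v + d ≡ n →
      ∃ λ q → v ≤ q × q < n × (∀ {k} → v < k → k ≤ q → ¬ U k) × (suc q < n → U (suc q))
    findEnd zero v eq = v , ℕ.≤-refl , ℕ.≤-reflexive (trans (sym (ℕ.+-identityʳ _)) eq) ,
      (λ v<k k≤v → ⊥-elim (ℕ.<⇒≱ v<k k≤v)) , λ lt → ⊥-elim (ℕ.<-irrefl (trans (sym (ℕ.+-identityʳ _)) eq) lt)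
    findEnd (suc d) v eq with U? (suc v)
    ... | yes u = v , ℕ.≤-refl , subst (suc v ≤_) eq (ℕ.m≤m+n (suc v) (suc d)) ,
      (λ v<k k≤v → ⊥-elim (ℕ.<⇒≱ v<k k≤v)) , λ _ → u
    ... | no ¬u with findEnd d (suc v) (trans (sym (ℕ.+-suc (suc v) d)) eq)
    ... | q , v<q , q<n , none , mx = q , ℕ.<⇒≤ v<q , q<n , (λ {k} v<k k≤q →
      case ℕ.m≤n⇒m<n∨m≡n v<k of λ { (inj₁ 1+v<k) → none 1+v<k k≤q ; (inj₂ refl) → ¬u }) , mx

  findRun : ∀ v → v < n → ∃₂ λ p q → IsRun n U p q × p ≤ v × v ≤ q
  findRun v v<n with findStart (U0 (ℕ.≤-<-trans z≤n v<n)) v | findEnd (n ∸ suc v) v (ℕ.m+[n∸m]≡n v<n)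
  ... | p , p≤v , u , none | q , v≤q , q<n , none′ , mx = p , q , record
    { q<n = q<n ; used = u
    ; unused = λ {k} p<k k≤q → case k ℕ.≤? v of λ
        { (yes k≤v) → none p<k k≤v ; (no k≰v) → none′ (ℕ.≰⇒> k≰v) k≤q }
    ; maximal = mx } , p≤v , v≤q

module Runs {n : ℕ} {U : ℕ → Set} (U? : Decidable U) (U0 : 0 < n → U 0) where

  abstract
    run : ∀ (v : Fin n) → ∃₂ λ p q → IsRun n U p q × p ≤ toℕ v × toℕ v ≤ q
    run v = findRun U? U0 (toℕ v) (Fin.toℕ<n v)

  start end : Fin n → ℕ
  start v = proj₁ (run v)
  end v   = proj₁ (proj₂ (run v))

  isRun : ∀ v → IsRun n U (start v) (end v)
  isRun v = proj₁ (proj₂ (proj₂ (run v)))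

  start≤ : ∀ v → start v ≤ toℕ v
  start≤ v = proj₁ (proj₂ (proj₂ (proj₂ (run v))))

  ≤end : ∀ v → toℕ v ≤ end v
  ≤end v = proj₂ (proj₂ (proj₂ (proj₂ (run v))))

  run-≡ : ∀ {u v} → start v ≤ toℕ u → toℕ u ≤ end v → start u ≡ start v × end u ≡ end v
  run-≡ {u} {v} s≤u u≤e = run-unique id id (isRun u) (start≤ u) (≤end u) (isRun v) s≤u u≤e

  end-cong : ∀ {u v} → start u ≡ start v → end u ≡ end v
  end-cong {u} {v} eq = proj₂ (run-unique id id
    (isRun u) ℕ.≤-refl (ℕ.≤-trans (start≤ u) (≤end u))
    (isRun v) (ℕ.≤-reflexive (sym eq)) (ℕ.≤-trans (ℕ.≤-reflexive eq) (ℕ.≤-trans (start≤ v) (≤end v))))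

  used-≤-start : ∀ {v k} → U k → k ≤ toℕ v → k ≤ start v
  used-≤-start {v} u k≤v = ℕ.≮⇒≥ λ s<k → unused (isRun v) s<k (ℕ.≤-trans k≤v (≤end v)) u

  -- The shifts c = 0 and c = 1 reverse a run and a run without its first element.
  reflect : ∀ c v → start v + c ≤ toℕ v →
            ∃ λ i → toℕ i + toℕ v ≡ c + (start v + end v) × start i ≡ start v × end i ≡ end v × start v + c ≤ toℕ i
  reflect c v s+c≤v = i , eq , proj₁ same , proj₂ same , s+c≤i
    where
    k : ℕ
    k = (end v ∸ toℕ v) + (start v + c)
    k≤e : k ≤ end v
    k≤e = ℕ.≤-trans (ℕ.+-monoʳ-≤ (end v ∸ toℕ v) s+c≤v) (ℕ.≤-reflexive (ℕ.m∸n+n≡m (≤end v)))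
    k<n : k < n
    k<n = ℕ.≤-<-trans k≤e (q<n (isRun v))
    i : Fin n
    i = fromℕ< k<n
    i≡k : toℕ i ≡ k
    i≡k = Fin.toℕ-fromℕ< k<n
    s+c≤i : start v + c ≤ toℕ i
    s+c≤i = ℕ.≤-trans (ℕ.m≤n+m (start v + c) (end v ∸ toℕ v)) (ℕ.≤-reflexive (sym i≡k))
    same : start i ≡ start v × end i ≡ end v
    same = run-≡ (ℕ.≤-trans (ℕ.m≤m+n (start v) c) s+c≤i) (ℕ.≤-trans (ℕ.≤-reflexive i≡k) k≤e)
    eq : toℕ i + toℕ v ≡ c + (start v + end v)
    eq = begin
      toℕ i + toℕ v                                 ≡⟨ cong (_+ toℕ v) i≡k ⟩
      (end v ∸ toℕ v) + (start v + c) + toℕ v       ≡⟨ ℕ.+-comm _ (toℕ v) ⟩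
      toℕ v + ((end v ∸ toℕ v) + (start v + c))     ≡⟨ ℕ.+-assoc (toℕ v) _ _ ⟨
      (toℕ v + (end v ∸ toℕ v)) + (start v + c)     ≡⟨ cong (_+ (start v + c)) (ℕ.m+[n∸m]≡n (≤end v)) ⟩
      end v + (start v + c)                         ≡⟨ ℕ.+-comm (end v) _ ⟩
      start v + c + end v                           ≡⟨ cong (_+ end v) (ℕ.+-comm (start v) c) ⟩
      c + start v + end v                           ≡⟨ ℕ.+-assoc c _ _ ⟩
      c + (start v + end v)                         ∎
      where open ≡-Reasoning

  private
    start+0≤ : ∀ v → start v + 0 ≤ toℕ v
    start+0≤ v = ℕ.≤-trans (ℕ.≤-reflexive (ℕ.+-identityʳ _)) (start≤ v)

  rev : Fin n → Fin n
  rev v = proj₁ (reflect 0 v (start+0≤ v))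

  rev-+ : ∀ v → toℕ (rev v) + toℕ v ≡ start v + end v
  rev-+ v = proj₁ (proj₂ (reflect 0 v (start+0≤ v)))

  start-rev : ∀ v → start (rev v) ≡ start v
  start-rev v = proj₁ (proj₂ (proj₂ (reflect 0 v (start+0≤ v))))

  end-rev : ∀ v → end (rev v) ≡ end v
  end-rev v = proj₁ (proj₂ (proj₂ (proj₂ (reflect 0 v (start+0≤ v)))))

  rev-unique : ∀ {i v} → toℕ i + toℕ v ≡ start v + end v → i ≡ rev v
  rev-unique {i} {v} eq = Fin.toℕ-injective (ℕ.+-cancelʳ-≡ (toℕ v) _ _ (trans eq (sym (rev-+ v))))

  rev-involutive : ∀ v → rev (rev v) ≡ v
  rev-involutive v = sym (rev-unique (trans (ℕ.+-comm (toℕ v) _)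
    (trans (rev-+ v) (sym (cong₂ _+_ (start-rev v) (end-rev v))))))

-- Transferring a code from one order on the letters to another

module Transfer {n N : ℕ} (b : Fin n → Fin (suc N)) (b≤ : ∀ v → toℕ (b v) ≤ toℕ v)
                (h : Fin (suc N) → ℕ) (h-injective : ∀ {y z} → h y ≡ h z → y ≡ z)
                (h-min : ∀ z → h zero ≤ h z) where

  U : ℕ → Set
  U k = ∃ λ v → toℕ (b v) ≡ k

  U? : Decidable U
  U? k = Fin.any? λ v → toℕ (b v) ℕ.≟ k

  U0 : 0 < n → U 0
  U0 0<n = fromℕ< 0<n , ℕ.n≤0⇒n≡0 (subst (toℕ (b (fromℕ< 0<n)) ≤_) (Fin.toℕ-fromℕ< 0<n) (b≤ (fromℕ< 0<n)))

  open Runs U? U0 public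

  Letter : ℕ → Fin (suc N) → Set
  Letter s z = ∃ λ u → start u ≡ s × b u ≡ z

  letter? : ∀ s → Decidable (Letter s)
  letter? s z = Fin.any? λ u → (start u ℕ.≟ s) ×-dec (b u Fin.≟ z)

  -- A letter `b u` is a value and at most `u`, and a run contains no value after its start. Hence
  -- letters can be rearranged and exchanged within a run without violating `a i ≤ i`.
  letter-≤ : ∀ {z} i → Letter (start i) z → toℕ z ≤ start i
  letter-≤ i (u , su≡si , refl) = subst (toℕ (b u) ≤_) su≡si (used-≤-start (u , refl) (b≤ u))

  letter-rev : ∀ i → Letter (start i) (b (rev i))
  letter-rev i = rev i , start-rev i , refl

  abstract
    private
      a-spec : ∀ i → ∃ λ z →
        Letter (start i) z × rank (letter? (start i)) toℕ z ≡ rank (letter? (start i)) h (b (rev i))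
      a-spec i = rank-surjective (letter? (start i)) Fin.toℕ-injective
                   (rank<# (letter? (start i)) h (letter-rev i))

    -- The increasing bijection from the letters of a run ordered by h to the
    -- same letters ordered by label, applied to the reversed run.
    a : Fin n → Fin (suc N)
    a i = proj₁ (a-spec i)

    a-letter : ∀ {s i} → start i ≡ s → Letter s (a i)
    a-letter {i = i} refl = proj₁ (proj₂ (a-spec i))

    a-rank : ∀ {s i v} → start i ≡ s → v ≡ rev i → rank (letter? s) toℕ (a i) ≡ rank (letter? s) h (b v)
    a-rank {i = i} refl refl = proj₂ (proj₂ (a-spec i))

  a≤ : ∀ i → toℕ (a i) ≤ toℕ i
  a≤ i = ℕ.≤-trans (letter-≤ i (a-letter refl)) (start≤ i)

  -- The letter whose rank under `h` equals the rank of `z` by label occurs at some `u` in the run,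
  -- and the mirror image of `u` then carries `z`. So a run keeps its set of letters.
  letter⇒a : ∀ {s z} → Letter s z → ∃ λ i → start i ≡ s × a i ≡ z
  letter⇒a {s} {z} Lz = rev u , si≡s ,
    rank-injective (letter? s) Fin.toℕ-injective (a-letter {s} {rev u} si≡s) Lz
      (trans (a-rank {s} {rev u} {u} si≡s (sym (rev-involutive u))) (trans (cong (rank (letter? s) h) bu≡y) eq))
    where
    preimage : ∃ λ y → Letter s y × rank (letter? s) h y ≡ rank (letter? s) toℕ z
    preimage = rank-surjective (letter? s) h-injective (rank<# (letter? s) toℕ Lz)
    u : Fin n
    u = proj₁ (proj₁ (proj₂ preimage))
    eq : rank (letter? s) h (proj₁ preimage) ≡ rank (letter? s) toℕ z
    eq = proj₂ (proj₂ preimage)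
    bu≡y : b u ≡ proj₁ preimage
    bu≡y = proj₂ (proj₂ (proj₁ (proj₂ preimage)))
    si≡s : start (rev u) ≡ s
    si≡s = trans (start-rev u) (proj₁ (proj₂ (proj₁ (proj₂ preimage))))

  a⇒letter : ∀ {s z} → (∃ λ i → start i ≡ s × a i ≡ z) → Letter s z
  a⇒letter (i , si≡s , refl) = a-letter si≡s

  U⇒a : ∀ {k} → U k → ∃ λ i → toℕ (a i) ≡ k
  U⇒a (v , refl) = let i , _ , eq = letter⇒a {start v} (v , refl , refl) in i , cong toℕ eq

  a⇒U : ∀ {k} → (∃ λ i → toℕ (a i) ≡ k) → U k
  a⇒U (i , refl) = let u , _ , eq = a-letter {start i} {i} refl in u , cong toℕ eq

  private
    -- The label `zero` is least in both orders, so the increasing bijection fixes it and zeros of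
    -- the code correspond to zeros.
    rank-zero : ∀ s → rank (letter? s) toℕ zero ≡ rank (letter? s) h zero
    rank-zero s = rank-ext (letter? s) (letter? s)
      (λ ()) (λ {z} (_ , lt) → ⊥-elim (ℕ.<⇒≱ lt (h-min z)))

    zero⁺ : ∀ i → a i ≡ zero → b (rev i) ≡ zero
    zero⁺ i ai≡0 = rank-injective (letter? s) h-injective (letter-rev i) (subst (Letter s) ai≡0 (a-letter refl))
      (trans (sym (a-rank {i = i} refl refl)) (trans (cong (rank (letter? s) toℕ) ai≡0) (rank-zero s)))
      where
      s : ℕ
      s = start i

    zero⁻ : ∀ i → b (rev i) ≡ zero → a i ≡ zero
    zero⁻ i bi≡0 = rank-injective (letter? s) Fin.toℕ-injective (a-letter refl) (subst (Letter s) bi≡0 (letter-rev i))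
      (trans (a-rank {i = i} refl refl) (trans (cong (rank (letter? s) h) bi≡0) (sym (rank-zero s))))
      where
      s : ℕ
      s = start i

  #-zeros : #[ (λ i → toℕ (a i) ℕ.≟ 0) ] ≡ #[ (λ v → toℕ (b v) ℕ.≟ 0) ]
  #-zeros = #-≡ (λ i → toℕ (a i) ℕ.≟ 0) (λ v → toℕ (b v) ℕ.≟ 0) (λ i v → v ≡ rev i)
    (λ {i} eq → rev i , cong toℕ (zero⁺ i (Fin.toℕ-injective eq)) , refl)
    (λ {i} {i′} _ _ p q → trans (sym (rev-involutive i)) (trans (cong rev (trans (sym p) q)) (rev-involutive i′)))
    (λ {v} eq → rev v ,
      cong toℕ (zero⁻ (rev v) (trans (cong b (rev-involutive v)) (Fin.toℕ-injective eq))) , sym (rev-involutive v))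
    (λ _ _ p q → trans p (sym q))

  -- Since `v′` is not a value, `v` and `v′` are neighbours in one run. Reversing the run turns this
  -- ascent for `h` into the descent required by `SillyIndex`.
  SillyLetter : Fin n → Set
  SillyLetter v′ = ∃ λ v → v ⋖ v′ × h (b v) < h (b v′) × ¬ U (toℕ v′)

  sillyLetter? : Decidable SillyLetter
  sillyLetter? v′ = Fin.any? λ v → (v ⋖? v′) ×-dec (h (b v) ℕ.<? h (b v′)) ×-dec (¬? (U? (toℕ v′)))

  private
    -- Reversal sends neighbours to neighbours: as `i + v′` exceeds the sum of the ends of the run
    -- by one, `v` is the mirror image of `i`, and `v′` that of `g`.
    module _ {g i v v′ : Fin n} (g⋖i : g ⋖ i) (v⋖v′ : v ⋖ v′) (eq : toℕ i + toℕ v′ ≡ suc (start i + end i))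
             (sg≡si : start g ≡ start i) where
      s : ℕ
      s = start i

      v≡rev-i : v ≡ rev i
      v≡rev-i = rev-unique (ℕ.suc-injective (trans (sym (ℕ.+-suc _ _))
        (trans (trans (ℕ.+-suc (toℕ v) (toℕ i)) (cong (_+ toℕ i) (sym v⋖v′))) (trans (ℕ.+-comm (toℕ v′) (toℕ i)) eq))))

      v′≡rev-g : v′ ≡ rev g
      v′≡rev-g = rev-unique (ℕ.suc-injective (trans (sym (ℕ.+-suc _ _)) (trans (cong (toℕ v′ +_) (sym g⋖i))
        (trans (ℕ.+-comm (toℕ v′) (toℕ i)) (trans eq (cong suc (cong₂ _+_ (sym sg≡si) (sym (end-cong sg≡si)))))))))

      rank-i : rank (letter? s) toℕ (a i) ≡ rank (letter? s) h (b v)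
      rank-i = a-rank refl v≡rev-i

      rank-g : rank (letter? s) toℕ (a g) ≡ rank (letter? s) h (b v′)
      rank-g = a-rank sg≡si v′≡rev-g

      descent⁺ : toℕ (a i) < toℕ (a g) → h (b v) < h (b v′)
      descent⁺ lt = rank-cancel-< (letter? s) h (subst₂ _<_ rank-i rank-g
        (rank-mono-< (letter? s) toℕ (a-letter refl) lt))

      descent⁻ : h (b v) < h (b v′) → toℕ (a i) < toℕ (a g)
      descent⁻ lt = rank-cancel-< (letter? s) toℕ (subst₂ _<_ (sym rank-i) (sym rank-g)
        (rank-mono-< (letter? s) h (v , trans (cong start v≡rev-i) (start-rev i) , refl) lt))

    record Mirror (i : Fin n) (j : Fin n) : Set where
      field
        {i⁻ j⁻} : Fin n
        i⁻⋖i : i⁻ ⋖ i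
        j⁻⋖j : j⁻ ⋖ j
        ij≡  : toℕ i + toℕ j ≡ suc (start i + end i)
        si⁻  : start i⁻ ≡ start i
        sj⁻  : start j⁻ ≡ start j
        sj   : start j ≡ start i
        ¬Uj  : ¬ U (toℕ j)

    -- An index that is not a value is not the start of its run. The reflection shifted by one
    -- permutes such indices of a run, and each of them has its predecessor in the same run.
    mirror : ∀ {i} → ¬ U (toℕ i) → ∃ λ j → Mirror i j
    mirror {i} ¬Ui with reflect 1 i s+1≤i
      where
      s+1≤i : start i + 1 ≤ toℕ i
      s+1≤i = ℕ.≤-trans (ℕ.≤-reflexive (ℕ.+-comm _ 1))
                (ℕ.≤∧≢⇒< (start≤ i) λ eq → ¬Ui (subst U eq (IsRun.used (isRun i))))
    ... | j , eq , sj , ej , s+1≤j = j , record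
      { i⁻⋖i = i⁻⋖i ; j⁻⋖j = j⁻⋖j ; ij≡ = trans (ℕ.+-comm (toℕ i) (toℕ j)) eq
      ; si⁻ = start-pred i⁻⋖i s<i ; sj⁻ = start-pred j⁻⋖j (subst (_< toℕ j) (sym sj) s<j) ; sj = sj
      ; ¬Uj = IsRun.unused (isRun j) (subst (_< toℕ j) (sym sj) s<j) (≤end j) }
      where
      s<j : start i < toℕ j
      s<j = ℕ.≤-trans (ℕ.≤-reflexive (ℕ.+-comm 1 _)) s+1≤j
      s<i : start i < toℕ i
      s<i = ℕ.≤∧≢⇒< (start≤ i) λ eq → ¬Ui (subst U eq (IsRun.used (isRun i)))
      start-pred : ∀ {k⁻ k} → k⁻ ⋖ k → start k < toℕ k → start k⁻ ≡ start k
      start-pred {k⁻} {k} k⁻⋖k s<k = proj₁ (run-≡ (s≤s⁻¹ (ℕ.≤-trans s<k (ℕ.≤-reflexive k⁻⋖k)))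
        (ℕ.≤-trans (ℕ.<⇒≤ (⋖⇒< k⁻⋖k)) (≤end k)))
      i⁻⋖i : proj₁ (⋖-pred s<i) ⋖ i
      i⁻⋖i = proj₂ (⋖-pred s<i)
      j⁻⋖j : proj₁ (⋖-pred s<j) ⋖ j
      j⁻⋖j = proj₂ (⋖-pred s<j)

  #-silly : #[ Code.sillyIndex? (toℕ ∘ a) ] ≡ #[ sillyLetter? ]
  #-silly = #-≡ (Code.sillyIndex? (toℕ ∘ a)) sillyLetter? R
    (λ {i} (g , g⋖i , lt , ¬u) →
      let v′ , m = mirror {i} (¬u ∘ U⇒a) in
      v′ , (j⁻ m , j⁻⋖j m , descent⁺ (i⁻⋖i m) (j⁻⋖j m) (ij≡ m) (si⁻ m)
              (subst (λ x → toℕ (a i) < toℕ (a x)) (⋖-unique g⋖i (i⁻⋖i m)) lt) , ¬Uj m) ,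
      ij≡ m , sj m)
    (λ {i} {i′} {v′} _ _ (p , q) (p′ , q′) → Fin.toℕ-injective (ℕ.+-cancelʳ-≡ (toℕ v′) _ _
      (trans p (trans (cong suc (run-sum (trans (sym q) q′))) (sym p′)))))
    (λ {v′} (v , v⋖v′ , lt , ¬u) →
      let i , m = mirror {v′} ¬u
          iv′≡  = trans (ℕ.+-comm (toℕ i) (toℕ v′)) (trans (ij≡ m) (cong suc (run-sum (sym (sj m)))))
      in i , (j⁻ m , j⁻⋖j m , descent⁻ (j⁻⋖j m) (i⁻⋖i m) iv′≡ (sj⁻ m)
              (subst (λ x → h (b x) < h (b v′)) (⋖-unique v⋖v′ (i⁻⋖i m)) lt) , ¬Uj m ∘ a⇒U) ,
      iv′≡ , sym (sj m))
    (λ {i} _ _ (p , q) (p′ , q′) → Fin.toℕ-injective (ℕ.+-cancelˡ-≡ (toℕ i) _ _ (trans p (sym p′))))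
    where
    open Mirror
    R : Fin n → Fin n → Set
    -- The second component identifies the runs of `i` and `v′`, so that `v′` determines `i` as
    -- well.
    R i v′ = toℕ i + toℕ v′ ≡ suc (start i + end i) × start v′ ≡ start i
    run-sum : ∀ {i j} → start i ≡ start j → start i + end i ≡ start j + end j
    run-sum eq = cong₂ _+_ eq (end-cong eq)

-- Recovering a letter from the transferred code

module _ {n N : ℕ} {b b′ : Fin n → Fin (suc N)} {b≤ : ∀ v → toℕ (b v) ≤ toℕ v} {b′≤ : ∀ v → toℕ (b′ v) ≤ toℕ v}
         {h h′ : Fin (suc N) → ℕ} {h-inj : ∀ {y z} → h y ≡ h z → y ≡ z} {h′-inj : ∀ {y z} → h′ y ≡ h′ z → y ≡ z}
         {h-min : ∀ z → h zero ≤ h z} {h′-min : ∀ z → h′ zero ≤ h′ z} where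

  private
    module T  = Transfer b  b≤  h  h-inj  h-min
    module T′ = Transfer b′ b′≤ h′ h′-inj h′-min

  module _ (a≡a′ : ∀ i → T.a i ≡ T′.a i) where

    private
      U⇒U′ : ∀ {k} → T.U k → T′.U k
      U⇒U′ u = let i , eq = T.U⇒a u in T′.a⇒U (i , trans (cong toℕ (sym (a≡a′ i))) eq)

      U′⇒U : ∀ {k} → T′.U k → T.U k
      U′⇒U u = let i , eq = T′.U⇒a u in T.a⇒U (i , trans (cong toℕ (a≡a′ i)) eq)

      run≡ : ∀ v → T.start v ≡ T′.start v × T.end v ≡ T′.end v
      run≡ v = run-unique U⇒U′ U′⇒U (T.isRun v) (T.start≤ v) (T.≤end v) (T′.isRun v) (T′.start≤ v) (T′.≤end v)

      start≡ : ∀ v → T.start v ≡ T′.start v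
      start≡ v = proj₁ (run≡ v)

      rev≡ : ∀ v → T.rev v ≡ T′.rev v
      rev≡ v = T′.rev-unique (trans (T.rev-+ v) (cong₂ _+_ (start≡ v) (proj₂ (run≡ v))))

      letter⇒ : ∀ {s z} → T.Letter s z → T′.Letter s z
      letter⇒ Lz = let i , si , eq = T.letter⇒a Lz in T′.a⇒letter (i , trans (sym (start≡ i)) si , trans (sym (a≡a′ i)) eq)

      letter⇐ : ∀ {s z} → T′.Letter s z → T.Letter s z
      letter⇐ Lz = let i , si , eq = T′.letter⇒a Lz in T.a⇒letter (i , trans (start≡ i) si , trans (a≡a′ i) eq)

    -- Equal transferred codes have the same values, hence the same runs with the same letters, and
    -- the rank of `b v` in its run can be read off. The letters of the run of `v` are at most `v`,
    -- so agreement of the two orders on these labels is enough to identify the letter; this permits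
    -- an induction on `v`.
    transfer-determines : ∀ v →
      (∀ {y z} → toℕ y ≤ toℕ v → toℕ z ≤ toℕ v → h y < h z → h′ y < h′ z) →
      (∀ {y z} → toℕ y ≤ toℕ v → toℕ z ≤ toℕ v → h′ y < h′ z → h y < h z) → b v ≡ b′ v
    transfer-determines v f g = rank-injective (T.letter? s) h-inj Lbv Lb′v (begin
      rank (T.letter? s) h (b v)        ≡⟨ T.a-rank (T.start-rev v) (sym (T.rev-involutive v)) ⟨
      rank (T.letter? s) toℕ (T.a i)    ≡⟨ cong (rank (T.letter? s) toℕ) (a≡a′ i) ⟩
      rank (T.letter? s) toℕ (T′.a i)   ≡⟨ rank-ext (T.letter? s) (T′.letter? s)
                                             (λ (p , q) → letter⇒ p , q) (λ (p , q) → letter⇐ p , q) ⟩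
      rank (T′.letter? s) toℕ (T′.a i)  ≡⟨ T′.a-rank si′ v≡ ⟩
      rank (T′.letter? s) h′ (b′ v)     ≡⟨ rank-ext (T′.letter? s) (T.letter? s)
                                             (λ (p , q) → letter⇐ p , g (≤v (letter⇐ p)) (b′≤ v) q)
                                             (λ (p , q) → letter⇒ p , f (≤v p) (b′≤ v) q) ⟩
      rank (T.letter? s) h (b′ v)       ∎)
      where
      open ≡-Reasoning
      s : ℕ
      s = T.start v
      i : Fin n
      i = T.rev v
      ≤v : ∀ {y} → T.Letter s y → toℕ y ≤ toℕ v
      ≤v p = ℕ.≤-trans (T.letter-≤ v p) (T.start≤ v)
      Lbv : T.Letter s (b v)
      Lbv = v , refl , refl
      Lb′v : T.Letter s (b′ v)
      Lb′v = letter⇐ (v , sym (start≡ v) , refl)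
      si′ : T′.start i ≡ s
      si′ = trans (sym (start≡ i)) (T.start-rev v)
      v≡ : v ≡ T′.rev i
      v≡ = trans (sym (T.rev-involutive v)) (rev≡ i)

-- The code of a permutation

argmax : ∀ {N} {P : Pred (Fin N) 0ℓ} → Decidable P → (μ : Fin N → ℕ) → ∃ P → ∃ λ z → P z × (∀ y → P y → μ y ≤ μ z)
argmax {suc N} {P} P? μ (x , px) with Fin.any? (P? ∘ suc)
... | no none = zero , only x px , λ
  { zero _ → ℕ.≤-refl ; (suc y) py → ⊥-elim (none (y , py)) }
  where
  only : ∀ x → P x → P zero
  only zero p    = p
  only (suc x) p = ⊥-elim (none (x , p))
... | yes some with argmax (P? ∘ suc) (μ ∘ suc) some | P? zero
... | z , pz , max | no ¬p0 = suc z , pz , λ { zero p0 → ⊥-elim (¬p0 p0) ; (suc y) py → max y py }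
... | z , pz , max | yes p0 with ℕ.≤-total (μ zero) (μ (suc z))
... | inj₁ le = suc z , pz , λ { zero _ → le ; (suc y) py → max y py }
... | inj₂ ge = zero , p0 , λ { zero _ → ℕ.≤-refl ; (suc y) py → ℕ.≤-trans (max y py) ge }

-- The label suc u stands for the gap immediately to the left of the value u,
-- and zero for the gap at the right end.
module NextSmaller {n : ℕ} (π : Vec (Fin n) n) (perm : IsPermutation π) where

  π⟨_⟩ : Fin n → Fin n
  π⟨ j ⟩ = lookup π j

  pos : Fin n → Fin n
  pos u = proj₁ (proj₂ perm u)

  π-pos : ∀ u → π⟨ pos u ⟩ ≡ u
  π-pos u = proj₂ (proj₂ perm u) refl

  π-injective : ∀ {i j} → π⟨ i ⟩ ≡ π⟨ j ⟩ → i ≡ j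
  π-injective = proj₁ perm

  pos-π : ∀ j → pos π⟨ j ⟩ ≡ j
  pos-π j = π-injective (π-pos π⟨ j ⟩)

  -- The number of gaps to the right.
  h : Fin (suc n) → ℕ
  h zero    = 0
  h (suc u) = n ∸ toℕ (pos u)

  h-suc>0 : ∀ u → 0 < h (suc u)
  h-suc>0 u = ℕ.m<n⇒0<n∸m (Fin.toℕ<n (pos u))

  h-min : ∀ z → h zero ≤ h z
  h-min z = z≤n

  h-injective : ∀ {y z} → h y ≡ h z → y ≡ z
  h-injective {zero}  {zero}  eq = refl
  h-injective {zero}  {suc u} eq = ⊥-elim (ℕ.<-irrefl eq (h-suc>0 u))
  h-injective {suc u} {zero}  eq = ⊥-elim (ℕ.<-irrefl (sym eq) (h-suc>0 u))
  h-injective {suc u} {suc w} eq = cong suc (trans (sym (π-pos u)) (trans (cong π⟨_⟩ (Fin.toℕ-injective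
    (ℕ.∸-cancelˡ-≡ (ℕ.<⇒≤ (Fin.toℕ<n (pos u))) (ℕ.<⇒≤ (Fin.toℕ<n (pos w))) eq))) (π-pos w)))

  h-π : ∀ j → h (suc π⟨ j ⟩) ≡ n ∸ toℕ j
  h-π j = cong (λ i → n ∸ toℕ i) (pos-π j)

  h-anti : ∀ {j k} → toℕ j < toℕ k → h (suc π⟨ k ⟩) < h (suc π⟨ j ⟩)
  h-anti {j} {k} j<k = subst₂ _<_ (sym (h-π k)) (sym (h-π j)) (ℕ.∸-monoʳ-< j<k (ℕ.<⇒≤ (Fin.toℕ<n k)))

  h-cancel : ∀ {j k} → h (suc π⟨ k ⟩) < h (suc π⟨ j ⟩) → toℕ j < toℕ k
  h-cancel {j} {k} lt = ℕ.≰⇒> λ k≤j → ℕ.<⇒≱ (subst₂ _<_ (h-π k) (h-π j) lt) (ℕ.∸-monoʳ-≤ n k≤j)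

  abstract
    private
      -- A label `suc u` is at most `v` iff `u < v`. Among the gaps of such labels to the right of
      -- `v`, the largest `h` belongs to the nearest, and `zero` remains when no smaller entry
      -- follows.
      next : ∀ v → ∃ λ z → (toℕ z ≤ toℕ v × h z < h (suc v)) ×
                           (∀ y → toℕ y ≤ toℕ v × h y < h (suc v) → h y ≤ h z)
      next v = argmax (λ z → (toℕ z ℕ.≤? toℕ v) ×-dec (h z ℕ.<? h (suc v))) h (zero , z≤n , h-suc>0 v)

    b : Fin n → Fin (suc n)
    b v = proj₁ (next v)

    b≤ : ∀ v → toℕ (b v) ≤ toℕ v
    b≤ v = proj₁ (proj₁ (proj₂ (next v)))

    h-b : ∀ v → h (b v) < h (suc v)
    h-b v = proj₂ (proj₁ (proj₂ (next v)))

    h-b-max : ∀ {v y} → toℕ y ≤ toℕ v → h y < h (suc v) → h y ≤ h (b v)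
    h-b-max {v} {y} p q = proj₂ (proj₂ (next v)) y (p , q)

  open Transfer b b≤ h h-injective h-min public

  private
    zero⁺ : ∀ {j} → IsRightToLeftMinimum π j → b π⟨ j ⟩ ≡ zero
    zero⁺ {j} rtl = go (b π⟨ j ⟩) refl
      where
      go : ∀ z → b π⟨ j ⟩ ≡ z → z ≡ zero
      go zero _     = refl
      go (suc u) eq = ⊥-elim (ℕ.<-asym
        (subst (λ x → toℕ x ≤ toℕ π⟨ j ⟩) (trans eq (cong suc (sym (π-pos u)))) (b≤ π⟨ j ⟩))
        (rtl (pos u) (h-cancel (subst (λ x → h x < h (suc π⟨ j ⟩)) (trans eq (cong suc (sym (π-pos u)))) (h-b π⟨ j ⟩)))))

    zero⁻ : ∀ {j} → b π⟨ j ⟩ ≡ zero → IsRightToLeftMinimum π j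
    zero⁻ {j} eq k j<k = ℕ.≰⇒> λ πk≤πj → ℕ.<⇒≱ (h-suc>0 π⟨ k ⟩) (subst (λ x → h (suc π⟨ k ⟩) ≤ h x) eq
      (h-b-max (ℕ.≤∧≢⇒< πk≤πj λ eq′ → ℕ.<-irrefl (cong toℕ (sym (π-injective (Fin.toℕ-injective eq′)))) j<k) (h-anti j<k)))

    descent⁺ : ∀ {j} → IsDescent π j → U (suc (toℕ π⟨ j ⟩))
    descent⁺ {j} (i , i⋖j , πj<πi) = π⟨ i ⟩ , cong toℕ (h-injective {b π⟨ i ⟩} {suc π⟨ j ⟩} (ℕ.≤-antisym
      -- From the gap before position `i` to the gap before position `j`, `h` drops by exactly one,
      -- so no gap lies in between.
      (s≤s⁻¹ (ℕ.<-≤-trans (h-b π⟨ i ⟩) (ℕ.≤-reflexive (begin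
        h (suc π⟨ i ⟩)       ≡⟨ h-π i ⟩
        n ∸ toℕ i            ≡⟨ ℕ.+-∸-assoc 1 i<n ⟩
        suc (n ∸ suc (toℕ i)) ≡⟨ cong (λ x → suc (n ∸ x)) i⋖j ⟨
        suc (n ∸ toℕ j)      ≡⟨ cong suc (h-π j) ⟨
        suc (h (suc π⟨ j ⟩)) ∎))))
      (h-b-max πj<πi (h-anti (⋖⇒< i⋖j)))))
      where
      open ≡-Reasoning
      i<n : suc (toℕ i) ≤ n
      i<n = Fin.toℕ<n i

    -- Let `π⟨ j ⟩` be the next smaller entry after `v`. If the entry before it were smaller still,
    -- that entry would differ from `v` and be a smaller entry nearer to `v`.
    descent⁻ : ∀ {j} → U (suc (toℕ π⟨ j ⟩)) → IsDescent π j
    descent⁻ {j} (v , eq) = proj₁ pred , proj₂ pred , ℕ.≰⇒> λ πi≤πj →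
      let πi<πj = ℕ.≤∧≢⇒< πi≤πj λ eq′ → ℕ.<-irrefl (cong toℕ (π-injective (Fin.toℕ-injective eq′))) (⋖⇒< i⋖j)
          πi<v  = ℕ.<-trans πi<πj πj<v
          k<i   = ℕ.≤∧≢⇒< (s≤s⁻¹ (ℕ.≤-trans k<j (ℕ.≤-reflexive i⋖j))) λ eq′ →
                    ℕ.<-irrefl (cong toℕ (trans (cong π⟨_⟩ (sym (Fin.toℕ-injective eq′))) (π-pos v))) πi<v
      in ℕ.<⇒≱ (h-anti (⋖⇒< i⋖j)) (subst (λ x → h (suc π⟨ i ⟩) ≤ h x) bv≡
           (h-b-max πi<v (subst (λ x → h (suc π⟨ i ⟩) < h (suc x)) (π-pos v) (h-anti k<i))))
      where
      bv≡ : b v ≡ suc π⟨ j ⟩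
      bv≡ = Fin.toℕ-injective eq
      πj<v : toℕ π⟨ j ⟩ < toℕ v
      πj<v = subst (λ x → toℕ x ≤ toℕ v) bv≡ (b≤ v)
      k<j : toℕ (pos v) < toℕ j
      k<j = h-cancel (subst₂ (λ x y → h x < h (suc y)) bv≡ (sym (π-pos v)) (h-b v))
      pred : ∃ λ i → i ⋖ j
      pred = ⋖-pred k<j
      i : Fin n
      i = proj₁ pred
      i⋖j : i ⋖ j
      i⋖j = proj₂ pred

    -- If `v′` stands to the left of `v`, the gap before `v` is a candidate for `b v′`, and the gap
    -- `b v` lies strictly to the right of it.
    left⁺ : ∀ {v v′} → v ⋖ v′ → h (suc v) < h (suc v′) → h (b v) < h (b v′)
    left⁺ {v} {v′} v⋖v′ lt = ℕ.<-≤-trans (h-b v) (h-b-max (ℕ.≤-reflexive (sym v⋖v′)) lt)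

    -- Otherwise the gap `b v′` lies to the right of `v`, and its label, being different from `v′`,
    -- is at most `v`. It is then a candidate for `b v`, so it cannot lie to the left of the gap
    -- `b v`.
    left⁻ : ∀ {v v′} → v ⋖ v′ → ¬ U (toℕ v′) → h (b v) < h (b v′) → h (suc v) < h (suc v′)
    left⁻ {v} {v′} v⋖v′ ¬u lt = ℕ.≰⇒> λ v′≤v → ℕ.<⇒≱ lt (h-b-max
      (s≤s⁻¹ (ℕ.≤-trans (ℕ.≤∧≢⇒< (b≤ v′) λ eq → ¬u (v′ , eq)) (ℕ.≤-reflexive v⋖v′)))
      (ℕ.<-≤-trans (h-b v′) v′≤v))

    -- A silly value is matched with its successor `v′`, because `v′` is also the label of the gap
    -- before position `j`: no descent at `j` means that `v′` is not a value of `b`.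
    silly⁺ : ∀ {j} → IsSilly π j → ∃ λ v′ → SillyLetter v′ × π⟨ j ⟩ ⋖ v′
    silly⁺ {j} (first , _ , k , k<j , πj⋖πk) = π⟨ k ⟩ ,
      (π⟨ j ⟩ , πj⋖πk , left⁺ πj⋖πk (h-anti k<j) , λ u → notDescent first (descent⁻ (subst U πj⋖πk u))) , πj⋖πk
      where
      notDescent : (toℕ j ≡ 0 ⊎ ∃ λ i → i ⋖ j × π⟨ i ⟩ Fin.< π⟨ j ⟩) → ¬ IsDescent π j
      notDescent (inj₁ j≡0) (i , i⋖j , _) = ℕ.0≢1+n (trans (sym j≡0) i⋖j)
      notDescent (inj₂ (i , i⋖j , lt)) (i′ , i′⋖j , gt) =
        ℕ.<-asym lt (subst (λ x → toℕ π⟨ j ⟩ < toℕ π⟨ x ⟩) (⋖-unique i′⋖j i⋖j) gt)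

    silly⁻ : ∀ {v′} → SillyLetter v′ → ∃ λ j → IsSilly π j × π⟨ j ⟩ ⋖ v′
    silly⁻ {v′} (v , v⋖v′ , lt , ¬u) = j ,
      -- As `v′` stands to the left of `v`, position `j` is not the first one and must be an ascent.
      (inj₂ (i , i⋖j , ℕ.≰⇒> λ πj≤πi → ¬u (subst U (sym πj⋖v′) (descent⁺ (i , i⋖j , ℕ.≤∧≢⇒< πj≤πi λ eq →
         ℕ.<-irrefl (cong toℕ (π-injective (Fin.toℕ-injective (sym eq)))) (⋖⇒< i⋖j))))) ,
       subst (_< n) πj⋖v′ (Fin.toℕ<n v′) ,
       pos v′ , k<j , subst (λ x → π⟨ j ⟩ ⋖ x) (sym (π-pos v′)) πj⋖v′) ,
      πj⋖v′
      where
      j : Fin n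
      j = pos v
      πj⋖v′ : π⟨ j ⟩ ⋖ v′
      πj⋖v′ = subst (_⋖ v′) (sym (π-pos v)) v⋖v′
      k<j : toℕ (pos v′) < toℕ j
      k<j = h-cancel (subst₂ (λ x y → h (suc x) < h (suc y)) (sym (π-pos v)) (sym (π-pos v′)) (left⁻ v⋖v′ ¬u lt))
      i : Fin n
      i = proj₁ (⋖-pred k<j)
      i⋖j : i ⋖ j
      i⋖j = proj₂ (⋖-pred k<j)

  rmin≡ : rmin π ≡ #[ (λ i → toℕ (a i) ℕ.≟ 0) ]
  rmin≡ = trans
    (#-≡ (isRightToLeftMinimum? π) (λ v → toℕ (b v) ℕ.≟ 0) (λ j v → π⟨ j ⟩ ≡ v)
      (λ {j} rtl → π⟨ j ⟩ , cong toℕ (zero⁺ rtl) , refl)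
      (λ _ _ p q → π-injective (trans p (sym q)))
      (λ {v} eq → pos v , zero⁻ (trans (cong b (π-pos v)) (Fin.toℕ-injective eq)) , π-pos v)
      (λ _ _ p q → trans (sym p) q))
    (sym #-zeros)

  p-silly≡ : p-silly π ≡ #[ Code.sillyIndex? (toℕ ∘ a) ]
  p-silly≡ = trans
    (#-≡ (isSilly? π) sillyLetter? (λ j v′ → π⟨ j ⟩ ⋖ v′)
      silly⁺ (λ _ _ p q → π-injective (⋖-unique p q))
      silly⁻ (λ _ _ p q → Fin.toℕ-injective (trans p (sym q))))
    (sym #-silly)

  -- The values of the code are zero, which `Fin 1` accounts for, and the labels `suc u` of the
  -- descent bottoms `u`.
  suc-des≡ : 0 < n → suc (des π) ≡ #[ Code.used? (toℕ ∘ a) ]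
  suc-des≡ 0<n = trans (cong (_+ des π) (sym (#-full 1)))
    (#-+ (λ (_ : Fin 1) → yes tt) (isDescent? π) (Code.used? (toℕ ∘ a)) R
      (λ { (inj₁ _) _ → fromℕ< 0<n , U⇒a (subst U (sym (Fin.toℕ-fromℕ< 0<n)) (U0 0<n)) , Fin.toℕ-fromℕ< 0<n
         ; (inj₂ j) d → let u = descent⁺ d ; lt = U-bound u in
             fromℕ< lt , U⇒a (subst U (sym (Fin.toℕ-fromℕ< lt)) u) , Fin.toℕ-fromℕ< lt })
      (λ { {inj₁ zero} {inj₁ zero} _ _ _ _ → refl
         ; {inj₁ _} {inj₂ _} _ _ p q → ⊥-elim (ℕ.0≢1+n (trans (sym p) q))
         ; {inj₂ _} {inj₁ _} _ _ p q → ⊥-elim (ℕ.0≢1+n (trans (sym q) p))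
         ; {inj₂ i} {inj₂ j} _ _ p q →
             cong inj₂ (π-injective (Fin.toℕ-injective (ℕ.suc-injective (trans (sym p) q)))) })
      (λ {k} u → find (toℕ k) refl (a⇒U u))
      (λ { {inj₁ _} _ _ p q → Fin.toℕ-injective (trans p (sym q))
         ; {inj₂ _} _ _ p q → Fin.toℕ-injective (trans p (sym q)) }))
    where
    R : Fin 1 ⊎ Fin n → Fin n → Set
    R (inj₁ _) k = toℕ k ≡ 0
    R (inj₂ j) k = toℕ k ≡ suc (toℕ π⟨ j ⟩)
    U-bound : ∀ {k} → U k → k < n
    U-bound (v , refl) = ℕ.≤-<-trans (b≤ v) (Fin.toℕ<n v)
    find : ∀ {k : Fin n} m → toℕ k ≡ m → U m → ∃ λ s → [ (λ _ → ⊤) , IsDescent π ]′ s × R s k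
    find zero eq u    = inj₁ zero , tt , eq
    find (suc m) eq u = inj₂ (pos w) , descent⁻ (subst U m≡ u) , trans eq m≡
      where
      m<n : m < n
      m<n = ℕ.<-trans (ℕ.n<1+n m) (U-bound u)
      w : Fin n
      w = fromℕ< m<n
      m≡ : suc m ≡ suc (toℕ π⟨ pos w ⟩)
      m≡ = cong suc (trans (sym (Fin.toℕ-fromℕ< m<n)) (cong toℕ (sym (π-pos w))))

  -- Positions are thus determined by the order that `h` puts on the labels.
  pos-rank : ∀ u → toℕ (pos u) ≡ #[ (λ w → h (suc u) ℕ.<? h (suc w)) ]
  pos-rank u = trans (sym (#-below (toℕ (pos u)) (ℕ.<⇒≤ (Fin.toℕ<n (pos u)))))
    (#-≡ (λ (j : Fin n) → toℕ j ℕ.<? toℕ (pos u)) (λ w → h (suc u) ℕ.<? h (suc w)) (λ j w → π⟨ j ⟩ ≡ w)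
      (λ {j} lt → π⟨ j ⟩ , subst (λ x → h (suc x) < h (suc π⟨ j ⟩)) (π-pos u) (h-anti lt) , refl)
      (λ _ _ p q → π-injective (trans p (sym q)))
      (λ {w} lt → pos w ,
        h-cancel (subst₂ (λ x y → h (suc x) < h (suc y)) (sym (π-pos u)) (sym (π-pos w)) lt) , π-pos w)
      (λ _ _ p q → trans (sym p) q))

-- Recovering a permutation from its transferred code

module _ {n : ℕ} where

  Agree : (h h′ : Fin (suc n) → ℕ) → ℕ → Set
  Agree h h′ m = ∀ {y z} → toℕ y ≤ m → toℕ z ≤ m → h y < h z → h′ y < h′ z

  -- Among the gaps with labels up to `suc v`, that of `suc v` comes immediately to the left of the
  -- gap `b v`. So the order of the labels up to `v` and the letter `b v` determine where `suc v` is
  -- inserted.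
  agree-suc : ∀ {π π′ : Vec (Fin n) n} (p : IsPermutation π) (p′ : IsPermutation π′) →
    ∀ v → NextSmaller.b π p v ≡ NextSmaller.b π′ p′ v →
    Agree (NextSmaller.h π p) (NextSmaller.h π′ p′) (toℕ v) →
    Agree (NextSmaller.h π′ p′) (NextSmaller.h π p) (toℕ v) →
    Agree (NextSmaller.h π p) (NextSmaller.h π′ p′) (suc (toℕ v))
  agree-suc {π} {π′} p p′ v bv≡ f g {y} {z} y≤ z≤ lt = case (label y y≤ , label z z≤) of λ
    { (inj₁ y≤v , inj₁ z≤v)   → f y≤v z≤v lt
    ; (inj₁ y≤v , inj₂ refl)  → below y≤v lt
    ; (inj₂ refl , inj₁ z≤v)  → ℕ.≤∧≢⇒<
        (ℕ.≮⇒≥ λ z<y → ℕ.<-asym lt (below′ z≤v z<y))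
        λ eq → ℕ.<-irrefl (cong P.h (P′.h-injective {suc v} {z} eq)) lt
    ; (inj₂ refl , inj₂ refl) → ⊥-elim (ℕ.<-irrefl refl lt) }
    where
    module P  = NextSmaller π p
    module P′ = NextSmaller π′ p′
    label : ∀ (x : Fin (suc n)) → toℕ x ≤ suc (toℕ v) → toℕ x ≤ toℕ v ⊎ x ≡ suc v
    label x x≤ with ℕ.m≤n⇒m<n∨m≡n x≤
    ... | inj₁ lt = inj₁ (s≤s⁻¹ lt)
    ... | inj₂ eq = inj₂ (Fin.toℕ-injective eq)
    below : ∀ {x} → toℕ x ≤ toℕ v → P.h x < P.h (suc v) → P′.h x < P′.h (suc v)
    below {x} x≤v lt = ℕ.≤-<-trans
      (ℕ.≮⇒≥ λ b<x → ℕ.<⇒≱ (subst (λ c → P.h c < P.h x) (sym bv≡) (g (P′.b≤ v) x≤v b<x)) (P.h-b-max x≤v lt))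
      (P′.h-b v)
    below′ : ∀ {x} → toℕ x ≤ toℕ v → P′.h x < P′.h (suc v) → P.h x < P.h (suc v)
    below′ {x} x≤v lt = ℕ.≤-<-trans
      (ℕ.≮⇒≥ λ b<x → ℕ.<⇒≱ (subst (λ c → P′.h c < P′.h x) bv≡ (f (P.b≤ v) x≤v b<x)) (P′.h-b-max x≤v lt))
      (P.h-b v)

  module _ {π π′ : Vec (Fin n) n} (p : IsPermutation π) (p′ : IsPermutation π′)
           (a≡a′ : ∀ i → NextSmaller.a π p i ≡ NextSmaller.a π′ p′ i) where

    private
      module P  = NextSmaller π p
      module P′ = NextSmaller π′ p′

      -- The order of the labels up to `m` suffices to decode the letter `b m` from the transferred
      -- code, and this letter places the next label.
      agree : ∀ m → m ≤ n → Agree P.h P′.h m × Agree P′.h P.h m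
      agree zero _ = (λ { {zero} {zero} _ _ () }) , (λ { {zero} {zero} _ _ () })
      agree (suc m) m<n =
        subst (λ k → Agree P.h P′.h (suc k) × Agree P′.h P.h (suc k)) (Fin.toℕ-fromℕ< m<n)
          (agree-suc p p′ v b≡ (λ {y} {z} → f {y} {z}) (λ {y} {z} → g {y} {z}) ,
           agree-suc p′ p v (sym b≡) (λ {y} {z} → g {y} {z}) (λ {y} {z} → f {y} {z}))
        where
        v : Fin n
        v = fromℕ< m<n
        f : Agree P.h P′.h (toℕ v)
        f = subst (Agree P.h P′.h) (sym (Fin.toℕ-fromℕ< m<n)) (proj₁ (agree m (ℕ.<⇒≤ m<n)))
        g : Agree P′.h P.h (toℕ v)
        g = subst (Agree P′.h P.h) (sym (Fin.toℕ-fromℕ< m<n)) (proj₂ (agree m (ℕ.<⇒≤ m<n)))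
        b≡ : P.b v ≡ P′.b v
        b≡ = transfer-determines {b≤ = P.b≤} {b′≤ = P′.b≤} {h-inj = P.h-injective} {h′-inj = P′.h-injective}
               {h-min = P.h-min} {h′-min = P′.h-min} a≡a′ v (λ {y} {z} → f {y} {z}) (λ {y} {z} → g {y} {z})

      pos≡ : ∀ u → P.pos u ≡ P′.pos u
      pos≡ u = Fin.toℕ-injective (trans (P.pos-rank u) (trans
        (#-ext (λ w → P.h (suc u) ℕ.<? P.h (suc w)) (λ w → P′.h (suc u) ℕ.<? P′.h (suc w))
          (λ {w} → proj₁ (agree n ℕ.≤-refl) {suc u} {suc w} (Fin.toℕ<n u) (Fin.toℕ<n w))
          (λ {w} → proj₂ (agree n ℕ.≤-refl) {suc u} {suc w} (Fin.toℕ<n u) (Fin.toℕ<n w)))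
        (sym (P′.pos-rank u))))

    a-injective : π ≡ π′
    a-injective = lookup-ext λ j → sym (trans
      (cong P′.π⟨_⟩ (trans (sym (P.pos-π j)) (pos≡ P.π⟨ j ⟩))) (P′.π-pos P.π⟨ j ⟩))

-- The correspondence between permutations and matchings

theorem8p3 : ∀ {c ℓ} (R : CommutativeSemiring c ℓ) → let open Polynomial R in
    (s x w : Carrier) (n : ℕ) .{{_ : NonZero n}} →
    (∑[ π ∈ 𝒮 n ] (s ^ rmin π * x ^ p-silly π * w ^ des π))
    ≈ (∑[ M ∈ 𝒩 n ] (s ^ min M * x ^ rne M * w ^ (int M ∸ 1)))
theorem8p3 R s x w n = sumOver-transport R (𝒮-unique n) total
  (λ {_} {_} {M} → injective {M = M}) (length-𝒩≤length-𝒮 n)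
  λ {π} {M} → weight π M
  where
  open Polynomial R using (_≈_; _^_) renaming (_*_ to _⊛_)
  code : (π : Vec (Fin n) n) → IsPermutation π → Fin n → ℕ
  code π p i = toℕ (NextSmaller.a π p i)
  code≤ : ∀ π p i → code π p i ≤ toℕ i
  code≤ π p = NextSmaller.a≤ π p
  _~_ : Vec (Fin n) n → Vec (Arc (2 ℕ.* n)) n → Set
  π ~ M = ∃ λ p → M codedBy code π p
  total : Total _~_ (𝒮 n) (𝒩 n)
  total {π} π∈ =
    let p         = ∈-𝒮⁻ π∈
        M , coded = codedMatching (code≤ π p)
    in M , ∈-𝒩⁺ (codedBy⇒isMatching (code≤ π p) {M} coded) (codedBy⇒noLeftNesting (code≤ π p) {M} coded) , p , coded
  injective : ∀ {π π′ M} → π ∈ 𝒮 n → π′ ∈ 𝒮 n → π ~ M → π′ ~ M → π ≡ π′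
  injective {π} {π′} {M} _ _ (p , coded) (p′ , coded′) = a-injective p p′ λ i →
    Fin.toℕ-injective (codedBy-injective {M = M} (code≤ π p) (code≤ π′ p′) coded coded′ i)
  weight : ∀ π M → π ~ M →
    (s ^ rmin π ⊛ x ^ p-silly π ⊛ w ^ des π) ≈ (s ^ min M ⊛ x ^ rne M ⊛ w ^ (int M ∸ 1))
  weight π M (p , coded) = CommutativeSemiring.reflexive R
    (cong₂ _⊛_ (cong₂ _⊛_ (cong (s ^_) rmin≡min) (cong (x ^_) silly≡rne)) (cong (w ^_) des≡int))
    where
    open NextSmaller π p
    rmin≡min : rmin π ≡ min M
    rmin≡min = trans rmin≡ (sym (codedBy⇒min (code≤ π p) {M} coded))
    silly≡rne : p-silly π ≡ rne M
    silly≡rne = trans p-silly≡ (sym (codedBy⇒rne (code≤ π p) {M} coded))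
    des≡int : des π ≡ int M ∸ 1
    des≡int = cong (_∸ 1) (trans (suc-des≡ (>-nonZero⁻¹ n)) (sym (codedBy⇒int (code≤ π p) {M} coded)))
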